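{- Let $d\in\mathbb N$ and let $\alpha>0$ and $\varepsilon>0$ be real numbers. Then the set \[ \left\{\,\operatorname{qcd}(P)\ \middle|\ P \text{ is a } d\text{ -dimensional lattice polytope with } \alpha\text{ -canonical normal fan and } \operatorname{qcd}(P)\ge \varepsilon\,\right\} \] is finite.
   Context: A lattice polytope $P\subseteq\mathbb R^d$ is a polytope all of whose vertices lie in $\mathbb Z^d$; a $d$-dimensional one is written (after a lattice-preserving change of coordinates) as $P=\{x\in\mathbb R^d\mid \langle a_i,x\rangle\le b_i,\ 1\le i\le n\}$, where the system is irredundant (no inequality can be dropped without changing $P$, so each defines a facet) and each $a_i\in(\mathbb Z^d)^*$ is primitive (the gcd of its entries is $1$). For rational $c>0$ the adjoint polytope is $P^{(c)}=\{x\mid \langle a_i,x\rangle\le b_i-c,\ 1\le i\le n\}$. The $\mathbb Q$-codegree $\operatorname{qcd}(P)$ is defined by $\operatorname{qcd}(P)^{ -1}=\max\{c>0\mid P^{(c)}\neq\emptyset\}$. The normal fan $\Sigma_P\subseteq(\mathbb R^d)^*$ is the complete fan whose cones are the cones $\operatorname{cone}(a_i\mid i\in I)$ where $I$ is the set of facets containing a given face of $P$; its rays are generated by $a_1,\dots,a_n$. For a rational polyhedral cone $\sigma$ with primitive ray generators $a_1,\dots,a_k$, the height of $y\in\sigma$ is $\operatorname{height}(y)=\max\{\sum_{i=1}^k\lambda_i\mid y=\sum_{i=1}^k\lambda_i a_i,\ \lambda_i\ge0\}$. The cone $\sigma$ is $\alpha$-canonical if $\operatorname{height}(y)\ge\alpha$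 for every nonzero $y\in\sigma\cap(\mathbb Z^d)^*$; a fan is $\alpha$-canonical if every cone in it is. -}

module Defs where

open import Level using (0ℓ)
open import Data.Nat using (ℕ)
open import Data.Nat.GCD using (gcd)
open import Data.Integer using (ℤ; ∣_∣; 0ℤ)
open import Data.Rational using (ℚ; 0ℚ; 1ℚ; _+_; _*_; _-_; -_; _/_; _≤_; _<_)
open import Data.Rational.Properties using (+-0-commutativeMonoid; <-dense; <-trans; <-asym; <-cmp; _<?_; +-monoʳ-<; +-identityʳ)
open import Data.Fin using (Fin)
open import Data.Fin.Subset using (Subset; _∈_; _∉_)
open import Data.Vec.Functional using (Vector; foldr)
open import Data.List using (List)
import Data.List.Membership.Propositional as List
open import Data.Product using (Σ; ∃; _×_; _,_)
open import Data.Sum using (_⊎_; inj₁; inj₂)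
open import Data.Unit using (tt)
open import Function using (_⇔_; mk⇔)
open import Relation.Nullary using (¬_)
open import Relation.Nullary.Decidable using (toWitness)
open import Relation.Unary using (Pred)
open import Relation.Binary.Definitions using (tri<; tri≈; tri>)
open import Relation.Binary.PropositionalEquality using (_≡_; _≢_; _≗_; refl; subst)
open import Algebra.Properties.CommutativeMonoid.Sum +-0-commutativeMonoid using (sum)

-- Real numbers as (two-sided) Dedekind cuts of ℚ.

record ℝ : Set₁ where
  field
    lower upper     : Pred ℚ 0ℓ
    lower-inhabited : ∃ lower
    upper-inhabited : ∃ upper
    lower-rounded   : ∀ q → lower q ⇔ (∃ λ r → q < r × lower r)
    upper-rounded   : ∀ q → upper q ⇔ (∃ λ r → r < q × upper r)
    disjoint        : ∀ q → ¬ (lower q × upper q)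
    located         : ∀ q r → q < r → lower q ⊎ upper r

open ℝ

infix 4 _<ℝ_ _≤ℝ_

_<ℝ_ : ℝ → ℝ → Set
x <ℝ y = ∃ λ q → upper x q × lower y q

_≤ℝ_ : ℝ → ℝ → Set
x ≤ℝ y = ∀ q → lower x q → lower y q

private
  p<p+1 : ∀ p → p < p + 1ℚ
  p<p+1 p = subst (_< p + 1ℚ) (+-identityʳ p) (+-monoʳ-< p (toWitness {a? = 0ℚ <? 1ℚ} tt))

  p-1<p : ∀ p → p - 1ℚ < p
  p-1<p p = subst (p - 1ℚ <_) (+-identityʳ p) (+-monoʳ-< p (toWitness {a? = - 1ℚ <? 0ℚ} tt))

fromℚ : ℚ → ℝ
fromℚ p = record
  { lower           = _< p
  ; upper           = p <_
  ; lower-inhabited = p - 1ℚ , p-1<p p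
  ; upper-inhabited = p + 1ℚ , p<p+1 p
  ; lower-rounded   = λ q → mk⇔ <-dense (λ (r , q<r , r<p) → <-trans q<r r<p)
  ; upper-rounded   = λ q → mk⇔ (λ p<q → let r , p<r , r<q = <-dense p<q in r , r<q , p<r) (λ (r , r<q , p<r) → <-trans p<r r<q)
  ; disjoint        = λ q (q<p , p<q) → <-asym q<p p<q
  ; located         = loc
  }
  where
  loc : ∀ q r → q < r → q < p ⊎ p < r
  loc q r q<r with <-cmp q p
  ... | tri< q<p _ _    = inj₁ q<p
  ... | tri≈ _ refl _   = inj₂ q<r
  ... | tri> _ _ p<q    = inj₂ (<-trans p<q q<r)

0ℝ : ℝ
0ℝ = fromℚ 0ℚ

-- A set of rationals is finite when its elements all occur in some list.
-- (An exact enumeration would require deciding membership in S.)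

Finite : Pred ℚ 0ℓ → Set
Finite S = Σ (List ℚ) λ qs → ∀ q → S q → q List.∈ qs

IsMaximum : Pred ℚ 0ℓ → ℚ → Set
IsMaximum S m = S m × (∀ q → S q → q ≤ m)

-- Points and functionals have rational coordinates: all polyhedra and cones
-- below are given by rational data.  Equality of points is pointwise, _≗_.

Point : ℕ → Set
Point d = Vector ℚ d

Lattice : ℕ → Set
Lattice d = Vector ℤ d

toℚ : ∀ {d} → Lattice d → Point d
toℚ z j = z j / 1

⟨_,_⟩ : ∀ {d} → Point d → Point d → ℚ
⟨ u , x ⟩ = sum (λ j → u j * x j)

combination : ∀ {d k} → Vector ℚ k → Vector (Point d) k → Point d
combination μ v j = sum (λ i → μ i * v i j)

ConvexHull : ∀ {d k} → Vector (Point d) k → Pred (Point d) 0ℓ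
ConvexHull {k = k} v x = Σ (Vector ℚ k) λ μ →
  (∀ i → 0ℚ ≤ μ i) × sum μ ≡ 1ℚ × combination μ v ≗ x

AffineHull : ∀ {d} → Pred (Point d) 0ℓ → Pred (Point d) 0ℓ
AffineHull {d} S x = Σ ℕ λ k → Σ (Vector (Point d) k) λ v → Σ (Vector ℚ k) λ μ →
  (∀ i → S (v i)) × sum μ ≡ 1ℚ × combination μ v ≗ x

IsPolytope : ∀ {d} → Pred (Point d) 0ℓ → Set
IsPolytope {d} S = Σ ℕ λ k → Σ (Vector (Point d) k) λ v → ∀ x → S x ⇔ ConvexHull v x

FullDimensional : ∀ {d} → Pred (Point d) 0ℓ → Set
FullDimensional S = ∀ x → AffineHull S x

-- Vertices as extreme points.

IsVertex : ∀ {d} → Pred (Point d) 0ℓ → Pred (Point d) 0ℓ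
IsVertex {d} S v = S v × (∀ (y z : Point d) (t : ℚ) → S y → S z → 0ℚ < t → t < 1ℚ →
  (∀ j → v j ≡ (1ℚ - t) * y j + t * z j) → y ≗ v × z ≗ v)

IsLatticePoint : ∀ {d} → Pred (Point d) 0ℓ
IsLatticePoint {d} x = Σ (Lattice d) λ z → x ≗ toℚ z

-- The face of S on which the functional u is maximal.

Face : ∀ {d} → Pred (Point d) 0ℓ → Point d → Pred (Point d) 0ℓ
Face S u x = S x × (∀ y → S y → ⟨ u , y ⟩ ≤ ⟨ u , x ⟩)

Primitive : ∀ {d} → Lattice d → Set
Primitive a = foldr (λ z g → gcd ∣ z ∣ g) 0 a ≡ 1

record LatticePolytope (d : ℕ) : Set where
  field
    n : ℕ
    a : Vector (Lattice d) n
    b : Vector ℚ n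

  Satisfies : Fin n → Pred (Point d) 0ℓ
  Satisfies i x = ⟨ toℚ (a i) , x ⟩ ≤ b i

  carrier : Pred (Point d) 0ℓ
  carrier x = ∀ i → Satisfies i x

  field
    isPrimitive     : ∀ i → Primitive (a i)
    irredundant     : ∀ i → ∃ λ x → (∀ j → j ≢ i → Satisfies j x) × ¬ Satisfies i x
    polytope        : IsPolytope carrier
    fullDimensional : FullDimensional carrier
    vertices        : ∀ v → IsVertex carrier v → IsLatticePoint v

  adjoint : ℚ → Pred (Point d) 0ℓ
  adjoint c x = ∀ i → ⟨ toℚ (a i) , x ⟩ ≤ b i - c

-- q is the ℚ-codegree of P, i.e. q⁻¹ is the maximum below.

IsQCodegree : ∀ {d} → LatticePolytope d → Pred ℚ 0ℓ
IsQCodegree P q = Σ ℚ λ c → IsMaximum (λ c → 0ℚ < c × ∃ (adjoint c)) c × q * c ≡ 1ℚ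
  where open LatticePolytope P

-- A cone is encoded by the set I of those indices i for which a i is one of
-- its ray generators; μ is a vector of coefficients supported on I.

ConicCombination : ∀ {d n} → Vector (Lattice d) n → Subset n → Lattice d → Vector ℚ n → Set
ConicCombination a I y μ =
  (∀ i → 0ℚ ≤ μ i) × (∀ i → i ∉ I → μ i ≡ 0ℚ) × combination μ (λ i → toℚ (a i)) ≗ toℚ y

InCone : ∀ {d n} → Vector (Lattice d) n → Subset n → Pred (Lattice d) 0ℓ
InCone a I y = ∃ (ConicCombination a I y)

IsHeight : ∀ {d n} → Vector (Lattice d) n → Subset n → Lattice d → Pred ℚ 0ℓ
IsHeight a I y = IsMaximum (λ s → ∃ λ μ → ConicCombination a I y μ × sum μ ≡ s)

CanonicalCone : ∀ {d n} → ℝ → Vector (Lattice d) n → Subset n → Set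
CanonicalCone α a I = ∀ y → ¬ (y ≗ λ _ → 0ℤ) → InCone a I y →
  ∃ λ h → IsHeight a I y h × α ≤ℝ fromℚ h

-- The cones of the normal fan: I is the set of facets containing the face of
-- P selected by some u (such a face is never empty, P being a nonempty polytope).

NormalFan : ∀ {d} (P : LatticePolytope d) → Pred (Subset (LatticePolytope.n P)) 0ℓ
NormalFan {d} P I = Σ (Point d) λ u → ∀ i →
  i ∈ I ⇔ (∀ x → Face carrier u x → ⟨ toℚ (a i) , x ⟩ ≡ b i)
  where open LatticePolytope P

CanonicalNormalFan : ∀ {d} → ℝ → LatticePolytope d → Set
CanonicalNormalFan α P = ∀ I → NormalFan P I → CanonicalCone α (LatticePolytope.a P) I

{-# OPTIONS --safe #-}

-- Let c = 1/qcd(P) and let x₀ be a point of P^(c).  Linear programming duality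
-- writes 0 = Σ ϑⱼ aⱼ with ϑ ≥ 0, Σ ϑⱼ = 1, Σ ϑⱼ bⱼ = c, where Fourier–Motzkin
-- elimination shows that 2^d terms suffice; the facets in its support are
-- tight at x₀.  Comparing the support function of P at a lattice point y with
-- ⟨ y , x₀ ⟩ shows that every representation y = Σ νⱼ aⱼ, ν ≥ 0, by these
-- facets has Σ νⱼ ≥ height(y) ≥ α unless y = 0.
--
-- By Dirichlet's theorem there are p ∈ ℕ^(2^d) and D = Σ pⱼ, bounded in terms
-- of d and α only, such that ν = (D + α′) ϑ − p ≥ 0, where 0 < α′ < α.  Since
-- Σ νⱼ = α′, the lattice point Σ νⱼ aⱼ = − Σ pⱼ aⱼ vanishes, whence
-- c D = Σ pⱼ bⱼ.  The bⱼ are integers, because every facet contains a lattice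
-- vertex.  So c has bounded denominator, and c ≤ 1/ε.
module Submission where

open import Defs
open import Data.Nat as ℕ using (ℕ; zero; suc; z≤n; s≤s)
import Data.Nat.DivMod as ℕ
import Data.Nat.Properties as ℕ
open import Data.Integer as ℤ using (ℤ; 0ℤ; -[1+_])
import Data.Integer.Properties as ℤ
open import Data.Rational
open import Data.Rational.Properties
open import Data.Rational.Solver
import Data.Rational.Unnormalised as ℚᵘ
import Data.Rational.Unnormalised.Properties as ℚᵘ
open import Data.Empty using (⊥; ⊥-elim)
open import Data.Fin as Fin using (Fin; zero; suc; toℕ; fromℕ<; funToFin; finToFun; punchIn; punchOut)
import Data.Fin.Properties as Fin
open import Data.Fin.Properties using (any?; all?; pigeonhole; finToFun-funToFin; punchIn-punchOut; toℕ-fromℕ<; toℕ<n)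
open import Data.Fin.Subset using (Subset; _∈_; _∉_)
open import Data.Fin.Subset.Properties using (_∈?_)
open import Data.List as List using (List; []; _∷_; length; allFin; upTo; cartesianProduct; cartesianProductWith)
import Data.List.Membership.Propositional as List
open import Data.List.Membership.Propositional using (find)
open import Data.List.Membership.Propositional.Properties using (∈-allFin; ∈-cartesianProduct⁺; ∈-cartesianProductWith⁺; ∈-upTo⁺)
open import Data.List.Relation.Unary.All as All using (All; []; _∷_)
import Data.List.Relation.Unary.All.Properties as All
open import Data.List.Relation.Unary.Any as Any using (here; there)
open import Data.Product
open import Data.Sum using (_⊎_; inj₁; inj₂; [_,_]′)
open import Data.Unit using (⊤; tt)
import Data.Vec as Vec
import Data.Vec.Properties as Vec
open import Data.Vec.Functional as Vector using (Vector; head; tail; insertAt; removeAt)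
open import Data.Vec.Functional.Properties using (insertAt-lookup; insertAt-punchIn)
open import Function using (_∘_; _⇔_; mk⇔; Equivalence)
open import Level using (0ℓ)
open import Relation.Binary.Definitions using (tri<; tri≈; tri>)
open import Relation.Binary.PropositionalEquality
open import Relation.Nullary using (¬_; Dec; yes; no; does; contradiction; _×-dec_; _→-dec_)
open import Relation.Nullary.Decidable using (dec-true)
open import Relation.Unary using (Pred)
open import Algebra.Properties.CommutativeMonoid.Sum +-0-commutativeMonoid using (sum; sum-cong-≗; ∑-distrib-+; ∑-comm; sum-remove)
open +-*-Solver

-- Rational arithmetic and finite sums

-- Two obstacles shape the argument. The facets tight at x₀ need not share a face of P, so their
-- normals need not lie in a common cone of the fan, and canonicity says nothing direct about
-- combinations of them; support functions transfer the height bound from whichever cone of the fan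
-- contains y. Moreover ν has to be nonnegative, whereas Dirichlet's theorem gives errors of either
-- sign. The surplus α′ ϑⱼ pays for the error at j only if ϑⱼ is not too small, and no positive
-- lower bound for the ϑⱼ is available. A coordinate that is too small is therefore given pⱼ = 0, at
-- the price of half of α′, and the others are treated by induction on the number of coordinates.
-- This is why the number of terms must be bounded by d alone, although P may have arbitrarily many
-- facets.

p≤q⇒0≤q-p : ∀ {p q} → p ≤ q → 0ℚ ≤ q - p
p≤q⇒0≤q-p {p} {q} p≤q = subst (_≤ q - p) (+-inverseʳ p) (+-monoˡ-≤ (- p) p≤q)

p<q⇒0<q-p : ∀ {p q} → p < q → 0ℚ < q - p
p<q⇒0<q-p {p} {q} p<q = subst (_< q - p) (+-inverseʳ p) (+-monoˡ-< (- p) p<q)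

q-p+p≡q : ∀ p q → (q - p) + p ≡ q
q-p+p≡q = solve 2 (λ p q → (q :- p) :+ p := q) refl

-- An inequality is proved by exhibiting the difference of its sides as a
-- manifestly nonnegative expression.
≤-via : ∀ {p q} r → 0ℚ ≤ r → q - p ≡ r → p ≤ q
≤-via {p} {q} r 0≤r eq = subst₂ _≤_ (+-identityˡ p) (q-p+p≡q p q) (+-monoˡ-≤ p (subst (0ℚ ≤_) (sym eq) 0≤r))

<-via : ∀ {p q} r → 0ℚ < r → q - p ≡ r → p < q
<-via {p} {q} r 0<r eq = subst₂ _<_ (+-identityˡ p) (q-p+p≡q p q) (+-monoˡ-< p (subst (0ℚ <_) (sym eq) 0<r))

q-p≡0⇒q≡p : ∀ {p q} → q - p ≡ 0ℚ → q ≡ p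
q-p≡0⇒q≡p {p} {q} eq = trans (sym (q-p+p≡q p q)) (trans (cong (_+ p) eq) (+-identityˡ p))

0≤-+ : ∀ {p q} → 0ℚ ≤ p → 0ℚ ≤ q → 0ℚ ≤ p + q
0≤-+ 0≤p 0≤q = +-mono-≤ 0≤p 0≤q

0<-+ : ∀ {p q} → 0ℚ < p → 0ℚ ≤ q → 0ℚ < p + q
0<-+ 0<p 0≤q = +-mono-<-≤ 0<p 0≤q

0≤-* : ∀ {p q} → 0ℚ ≤ p → 0ℚ ≤ q → 0ℚ ≤ p * q
0≤-* {p} {q} 0≤p 0≤q = subst (_≤ p * q) (*-zeroʳ p) (*-monoˡ-≤-nonNeg p {{nonNegative 0≤p}} 0≤q)

0<-* : ∀ {p q} → 0ℚ < p → 0ℚ < q → 0ℚ < p * q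
0<-* {p} {q} 0<p 0<q = subst (_< p * q) (*-zeroʳ p) (*-monoʳ-<-pos p {{positive 0<p}} 0<q)

0<-*⁻ : ∀ {p q} → 0ℚ < p → 0ℚ < p * q → 0ℚ < q
0<-*⁻ {p} {q} 0<p 0<pq = *-cancelˡ-<-nonNeg p {{nonNegative (<⇒≤ 0<p)}} (subst (_< p * q) (sym (*-zeroʳ p)) 0<pq)

0≤-*⁻ : ∀ {p q} → 0ℚ < p → 0ℚ ≤ p * q → 0ℚ ≤ q
0≤-*⁻ {p} {q} 0<p 0≤pq = *-cancelˡ-≤-pos p {{positive 0<p}} (subst (_≤ p * q) (sym (*-zeroʳ p)) 0≤pq)

p≤0⇒0≤-p : ∀ {p} → p ≤ 0ℚ → 0ℚ ≤ - p
p≤0⇒0≤-p = neg-antimono-≤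

p<0⇒0<-p : ∀ {p} → p < 0ℚ → 0ℚ < - p
p<0⇒0<-p = neg-antimono-<

0≤1 : 0ℚ ≤ 1ℚ
0≤1 = nonNegative⁻¹ 1ℚ

0<1 : 0ℚ < 1ℚ
0<1 = positive⁻¹ 1ℚ

opaque
  reciprocal : ∀ {p} → 0ℚ < p → ∃ λ r → 0ℚ < r × r * p ≡ 1ℚ
  reciprocal {p} 0<p = 1/ p , positive⁻¹ (1/ p) {{1/pos⇒pos p}} , *-inverseˡ p
    where
    instance
      p-pos : Positive p
      p-pos = positive 0<p
      p-nz : NonZero p
      p-nz = pos⇒nonZero p

pq≡0⇒q≡0 : ∀ {p q} → 0ℚ < p → p * q ≡ 0ℚ → q ≡ 0ℚ
pq≡0⇒q≡0 {p} {q} 0<p pq≡0 with r , _ , rp≡1 ← reciprocal 0<p = begin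
  q            ≡⟨ *-identityˡ q ⟨
  1ℚ * q       ≡⟨ cong (_* q) rp≡1 ⟨
  r * p * q    ≡⟨ *-assoc r p q ⟩
  r * (p * q)  ≡⟨ cong (r *_) pq≡0 ⟩
  r * 0ℚ       ≡⟨ *-zeroʳ r ⟩
  0ℚ           ∎
  where open ≡-Reasoning

sum-*ˡ : ∀ {n} r (f : Vector ℚ n) → sum (λ i → r * f i) ≡ r * sum f
sum-*ˡ {zero}  r f = sym (*-zeroʳ r)
sum-*ˡ {suc n} r f = trans (cong (r * f zero +_) (sum-*ˡ r (λ i → f (suc i)))) (sym (*-distribˡ-+ r (f zero) _))

sum-*ʳ : ∀ {n} r (f : Vector ℚ n) → sum (λ i → f i * r) ≡ sum f * r
sum-*ʳ r f = trans (sum-cong-≗ (λ i → *-comm (f i) r)) (trans (sum-*ˡ r f) (*-comm r _))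

sum-neg : ∀ {n} (f : Vector ℚ n) → sum (λ i → - f i) ≡ - sum f
sum-neg {zero}  f = refl
sum-neg {suc n} f = trans (cong (- f zero +_) (sum-neg (λ i → f (suc i)))) (sym (neg-distrib-+ (f zero) _))

sum-sub : ∀ {n} (f g : Vector ℚ n) → sum (λ i → f i - g i) ≡ sum f - sum g
sum-sub f g = trans (∑-distrib-+ f (λ i → - g i)) (cong (sum f +_) (sum-neg g))

sum-zero : ∀ {n} (f : Vector ℚ n) → (∀ i → f i ≡ 0ℚ) → sum f ≡ 0ℚ
sum-zero {zero}  f f≡0 = refl
sum-zero {suc n} f f≡0 = cong₂ _+_ (f≡0 zero) (sum-zero _ (λ i → f≡0 (suc i)))

sum-nonneg : ∀ {n} (f : Vector ℚ n) → (∀ i → 0ℚ ≤ f i) → 0ℚ ≤ sum f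
sum-nonneg {zero}  f 0≤f = ≤-refl
sum-nonneg {suc n} f 0≤f = 0≤-+ (0≤f zero) (sum-nonneg _ (λ i → 0≤f (suc i)))

sum-mono : ∀ {n} (f g : Vector ℚ n) → (∀ i → f i ≤ g i) → sum f ≤ sum g
sum-mono {zero}  f g f≤g = ≤-refl
sum-mono {suc n} f g f≤g = +-mono-≤ (f≤g zero) (sum-mono _ _ (λ i → f≤g (suc i)))

+-≡0ˡ : ∀ {p q} → 0ℚ ≤ p → 0ℚ ≤ q → p + q ≡ 0ℚ → p ≡ 0ℚ
+-≡0ˡ {p} {q} 0≤p 0≤q eq = ≤-antisym (≤-via q 0≤q (trans (cong (_- p) (sym eq)) (solve 2 (λ p q → p :+ q :- p := q) refl p q))) 0≤p

sum≡0⇒≡0 : ∀ {n} (f : Vector ℚ n) → (∀ i → 0ℚ ≤ f i) → sum f ≡ 0ℚ → ∀ i → f i ≡ 0ℚ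
sum≡0⇒≡0 {suc n} f 0≤f eq zero    = +-≡0ˡ (0≤f zero) (sum-nonneg _ (λ i → 0≤f (suc i))) eq
sum≡0⇒≡0 {suc n} f 0≤f eq (suc i) = sum≡0⇒≡0 _ (λ i → 0≤f (suc i))
  (+-≡0ˡ (sum-nonneg _ (λ i → 0≤f (suc i))) (0≤f zero) (trans (+-comm _ (f zero)) eq)) i

-- Weighted lists of inequalities

-- A list instead of a coefficient vector over all of `X`: its length is what elimination keeps
-- independent of the number of inequalities. An index may occur several times.
Certificate : Set → Set
Certificate X = List (ℚ × X)

weight : ∀ {X} (l : Certificate X) → Vector ℚ (length l)
weight l j = proj₁ (List.lookup l j)

index : ∀ {X} (l : Certificate X) → Fin (length l) → X
index l j = proj₂ (List.lookup l j)

value : ∀ {X} → Certificate X → (X → ℚ) → ℚ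
value l f = sum (λ j → weight l j * f (index l j))

NonNegativeWeights : ∀ {X} → Certificate X → Set
NonNegativeWeights l = ∀ j → 0ℚ ≤ weight l j

value-cong : ∀ {X} (l : Certificate X) {f g : X → ℚ} → (∀ x → f x ≡ g x) → value l f ≡ value l g
value-cong l f≗g = sum-cong-≗ (λ j → cong (weight l j *_) (f≗g (index l j)))

value-sub : ∀ {X} (l : Certificate X) (f g : X → ℚ) → value l (λ x → f x - g x) ≡ value l f - value l g
value-sub l f g = trans
  (sum-cong-≗ (λ j → solve 3 (λ w p q → w :* (p :- q) := w :* p :- w :* q) refl (weight l j) (f (index l j)) (g (index l j))))
  (sum-sub (λ j → weight l j * f (index l j)) (λ j → weight l j * g (index l j)))

value-*ˡ : ∀ {X} (l : Certificate X) r (f : X → ℚ) → value l (λ x → r * f x) ≡ r * value l f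
value-*ˡ l r f = trans
  (sum-cong-≗ (λ j → solve 3 (λ w r p → w :* (r :* p) := r :* (w :* p)) refl (weight l j) r (f (index l j))))
  (sum-*ˡ r (λ j → weight l j * f (index l j)))

value-zero : ∀ {X} (l : Certificate X) (f : X → ℚ) → (∀ x → f x ≡ 0ℚ) → value l f ≡ 0ℚ
value-zero l f f≡0 = sum-zero _ (λ j → trans (cong (weight l j *_) (f≡0 _)) (*-zeroʳ (weight l j)))

value-mono : ∀ {X} (l : Certificate X) → NonNegativeWeights l → (f g : X → ℚ) → (∀ x → f x ≤ g x) → value l f ≤ value l g
value-mono l 0≤l f g f≤g = sum-mono _ _ (λ j → *-monoˡ-≤-nonNeg (weight l j) {{nonNegative (0≤l j)}} (f≤g (index l j)))

Annihilates : ∀ {X d} → Certificate X → (X → Point d) → Set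
Annihilates l a = ∀ k → value l (λ x → a x k) ≡ 0ℚ

value-⟨,⟩ : ∀ {X d} (l : Certificate X) (a : X → Point d) (x : Point d) →
  value l (λ i → ⟨ a i , x ⟩) ≡ sum (λ k → value l (λ i → a i k) * x k)
value-⟨,⟩ l a x = begin
  value l (λ i → ⟨ a i , x ⟩)
    ≡⟨ sum-cong-≗ (λ j → sym (sum-*ˡ (weight l j) (λ k → a (index l j) k * x k))) ⟩
  sum (λ j → sum (λ k → weight l j * (a (index l j) k * x k)))
    ≡⟨ ∑-comm (λ j k → weight l j * (a (index l j) k * x k)) ⟩
  sum (λ k → sum (λ j → weight l j * (a (index l j) k * x k)))
    ≡⟨ sum-cong-≗ (λ k → trans (sum-cong-≗ (λ j → sym (*-assoc (weight l j) (a (index l j) k) (x k)))) (sum-*ʳ (x k) (λ j → weight l j * a (index l j) k))) ⟩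
  sum (λ k → value l (λ i → a i k) * x k) ∎
  where open ≡-Reasoning

annihilates-⟨,⟩ : ∀ {X d} (l : Certificate X) (a : X → Point d) → Annihilates l a →
  ∀ x → value l (λ i → ⟨ a i , x ⟩) ≡ 0ℚ
annihilates-⟨,⟩ l a ann x = trans (value-⟨,⟩ l a x)
  (sum-zero _ (λ k → trans (cong (_* x k) (ann k)) (*-zeroˡ (x k))))

-- Fourier–Motzkin elimination

-- A row with `α j < 0` bounds the variable from below. A row attaining the largest such bound is
-- returned too, since `one-variable` has to pair it with the upper bounds.
tightest-lower-bound : ∀ {X : Set} (xs : List X) (α r : X → ℚ) →
  (∀ {j} → j List.∈ xs → ¬ (α j < 0ℚ)) ⊎
  (∃ λ x₀ → (∀ {j} → j List.∈ xs → α j < 0ℚ → α j * x₀ ≤ r j) ×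
            (∃ λ j → j List.∈ xs × α j < 0ℚ × α j * x₀ ≡ r j))
tightest-lower-bound [] α r = inj₁ λ ()
tightest-lower-bound {X} (x ∷ xs) α r with α x <? 0ℚ | tightest-lower-bound xs α r
... | no αx≮0 | inj₁ none = inj₁ λ { (here refl) → αx≮0 ; (there j∈) → none j∈ }
... | no αx≮0 | inj₂ (x₀ , ok , j , j∈ , tight) = inj₂ (x₀ ,
  (λ { (here refl) αx<0 → contradiction αx<0 αx≮0 ; (there j∈) → ok j∈ }) , j , there j∈ , tight)
... | yes αx<0 | rest = inj₂ (combine rest)
  where
  inverse = reciprocal (p<0⇒0<-p αx<0)
  s = proj₁ inverse
  t = - (s * r x)

  αt≡r : α x * t ≡ r x
  αt≡r = trans (solve 3 (λ α s r → α :* (:- (s :* r)) := (s :* (:- α)) :* r) refl (α x) s (r x))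
    (trans (cong (_* r x) (proj₂ (proj₂ inverse))) (*-identityˡ (r x)))

  antitone : ∀ {β p q} → β < 0ℚ → p ≤ q → β * q ≤ β * p
  antitone {β} β<0 p≤q = *-monoˡ-≤-nonPos β {{nonPositive (<⇒≤ β<0)}} p≤q

  combine : _ → _
  combine (inj₁ none) = t ,
    (λ { (here refl) _ → ≤-reflexive αt≡r ; (there j∈) αj<0 → contradiction αj<0 (none j∈) }) , x , here refl , αx<0 , αt≡r
  combine (inj₂ (x₀ , ok , j , j∈ , αj<0 , tight)) with ≤-total t x₀
  ... | inj₁ t≤x₀ = x₀ ,
    (λ { (here refl) _ → ≤-trans (antitone αx<0 t≤x₀) (≤-reflexive αt≡r) ; (there j∈) → ok j∈ }) , j , there j∈ , αj<0 , tight
  ... | inj₂ x₀≤t = t ,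
    (λ { (here refl) _ → ≤-reflexive αt≡r ; (there j∈) αj<0 → ≤-trans (antitone αj<0 x₀≤t) (ok j∈ αj<0) }) , x , here refl , αx<0 , αt≡r

-- By the condition on pairs, the tightest lower bound satisfies every upper bound, so it is a
-- solution. Without lower bounds, the same search with negated coefficients yields the tightest
-- upper bound.
one-variable : ∀ {X : Set} (xs : List X) (α r : X → ℚ) →
  (∀ {i} → i List.∈ xs → α i ≡ 0ℚ → 0ℚ ≤ r i) →
  (∀ {i j} → i List.∈ xs → j List.∈ xs → 0ℚ < α i → α j < 0ℚ → 0ℚ ≤ - α j * r i + α i * r j) →
  ∃ λ x₀ → ∀ {i} → i List.∈ xs → α i * x₀ ≤ r i
one-variable {X} xs α r zeros pairs = solution (tightest-lower-bound xs α r) (tightest-lower-bound xs (λ i → - α i) r)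
  where
  at-zero : ∀ {i} x₀ → i List.∈ xs → α i ≡ 0ℚ → α i * x₀ ≤ r i
  at-zero {i} x₀ i∈ αi≡0 = subst (_≤ r i) (sym (trans (cong (_* x₀) αi≡0) (*-zeroˡ x₀))) (zeros i∈ αi≡0)

  solution : _ → _ → ∃ λ x₀ → ∀ {i} → i List.∈ xs → α i * x₀ ≤ r i
  solution (inj₂ (x₀ , ok , j , j∈ , αj<0 , tight)) _ = x₀ , satisfied
    where
    satisfied : ∀ {i} → i List.∈ xs → α i * x₀ ≤ r i
    satisfied {i} i∈ with <-cmp (α i) 0ℚ
    ... | tri< αi<0 _ _ = ok i∈ αi<0
    ... | tri≈ _ αi≡0 _ = at-zero x₀ i∈ αi≡0
    ... | tri> _ _ 0<αi = ≤-via (r i - α i * x₀) (0≤-*⁻ (p<0⇒0<-p αj<0) (subst (0ℚ ≤_) eq (pairs i∈ j∈ 0<αi αj<0))) refl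
      where
      eq : - α j * r i + α i * r j ≡ - α j * (r i - α i * x₀)
      eq = trans (cong (λ z → - α j * r i + α i * z) (sym tight))
        (solve 4 (λ a b r x → (:- b) :* r :+ a :* (b :* x) := (:- b) :* (r :- a :* x)) refl (α i) (α j) (r i) x₀)
  solution (inj₁ none) (inj₁ none⁻) = 0ℚ , satisfied
    where
    satisfied : ∀ {i} → i List.∈ xs → α i * 0ℚ ≤ r i
    satisfied {i} i∈ with <-cmp (α i) 0ℚ
    ... | tri< αi<0 _ _ = contradiction αi<0 (none i∈)
    ... | tri≈ _ αi≡0 _ = at-zero 0ℚ i∈ αi≡0
    ... | tri> _ _ 0<αi = contradiction (neg-antimono-< 0<αi) (none⁻ i∈)
  solution (inj₁ none) (inj₂ (x₀ , ok , _)) = - x₀ , satisfied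
    where
    satisfied : ∀ {i} → i List.∈ xs → α i * - x₀ ≤ r i
    satisfied {i} i∈ with <-cmp (α i) 0ℚ
    ... | tri< αi<0 _ _ = contradiction αi<0 (none i∈)
    ... | tri≈ _ αi≡0 _ = at-zero (- x₀) i∈ αi≡0
    ... | tri> _ _ 0<αi = subst (_≤ r i) (solve 2 (λ p x → (:- p) :* x := p :* (:- x)) refl (α i) x₀) (ok i∈ (neg-antimono-< 0<αi))

-- Weights combining rows with leading coefficients p and q.  Pairs that are
-- not needed get zero weights, so that all certificates have length 2^d.
elimination : ℚ → ℚ → ℚ × ℚ
elimination p q with <-cmp p 0ℚ | q <? 0ℚ
... | tri≈ _ _ _ | _     = 1ℚ , 0ℚ
... | tri> _ _ _ | yes _ = - q , p
... | tri> _ _ _ | no _  = 0ℚ , 0ℚ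
... | tri< _ _ _ | _     = 0ℚ , 0ℚ

elimination-≡0 : ∀ p q → p ≡ 0ℚ → elimination p q ≡ (1ℚ , 0ℚ)
elimination-≡0 p q p≡0 with <-cmp p 0ℚ | q <? 0ℚ
... | tri≈ _ _ _ | _     = refl
... | tri> _ p≢0 _ | yes _ = contradiction p≡0 p≢0
... | tri> _ p≢0 _ | no _  = contradiction p≡0 p≢0
... | tri< _ p≢0 _ | _     = contradiction p≡0 p≢0

elimination-pair : ∀ p q → 0ℚ < p → q < 0ℚ → elimination p q ≡ (- q , p)
elimination-pair p q 0<p q<0 with <-cmp p 0ℚ | q <? 0ℚ
... | tri≈ _ _ p≯0 | _     = contradiction 0<p p≯0
... | tri> _ _ _ | yes _ = refl
... | tri> _ _ _ | no q≮0  = contradiction q<0 q≮0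
... | tri< _ _ p≯0 | _     = contradiction 0<p p≯0

elimination-nonneg : ∀ p q → 0ℚ ≤ proj₁ (elimination p q) × 0ℚ ≤ proj₂ (elimination p q)
elimination-nonneg p q with <-cmp p 0ℚ | q <? 0ℚ
... | tri≈ _ _ _ | _     = 0≤1 , ≤-refl
... | tri> _ _ 0<p | yes q<0 = <⇒≤ (p<0⇒0<-p q<0) , <⇒≤ 0<p
... | tri> _ _ _ | no _  = ≤-refl , ≤-refl
... | tri< _ _ _ | _     = ≤-refl , ≤-refl

elimination-cancels : ∀ p q → proj₁ (elimination p q) * p + proj₂ (elimination p q) * q ≡ 0ℚ
elimination-cancels p q with <-cmp p 0ℚ | q <? 0ℚ
... | tri≈ _ p≡0 _ | _   = trans (solve 2 (λ p q → con 1ℚ :* p :+ con 0ℚ :* q := p) refl p q) p≡0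
... | tri> _ _ _ | yes _ = solve 2 (λ p q → (:- q) :* p :+ p :* q := con 0ℚ) refl p q
... | tri> _ _ _ | no _  = solve 2 (λ p q → con 0ℚ :* p :+ con 0ℚ :* q := con 0ℚ) refl p q
... | tri< _ _ _ | _     = solve 2 (λ p q → con 0ℚ :* p :+ con 0ℚ :* q := con 0ℚ) refl p q

module Expansion {X : Set} (u v : X × X → ℚ) where

  mix : (X → ℚ) → X × X → ℚ
  mix f ij = u ij * f (proj₁ ij) + v ij * f (proj₂ ij)

  expand : Certificate (X × X) → Certificate X
  expand []             = []
  expand ((w , ij) ∷ l) = (w * u ij , proj₁ ij) ∷ (w * v ij , proj₂ ij) ∷ expand l

  length-expand : ∀ l → length (expand l) ≡ 2 ℕ.* length l
  length-expand []      = refl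
  length-expand (_ ∷ l) = trans (cong (ℕ.suc ∘ ℕ.suc) (length-expand l)) (sym (ℕ.*-suc 2 (length l)))

  -- Expansion is the transpose of `mix`: certificates for the combined rows pull back to
  -- certificates for the original ones.
  value-expand : ∀ l f → value (expand l) f ≡ value l (mix f)
  value-expand []             f = refl
  value-expand ((w , ij) ∷ l) f = trans
    (cong (λ z → w * u ij * f (proj₁ ij) + (w * v ij * f (proj₂ ij) + z)) (value-expand l f))
    (solve 6 (λ w u v p q z → w :* u :* p :+ (w :* v :* q :+ z) := w :* (u :* p :+ v :* q) :+ z) refl
      w (u ij) (v ij) (f (proj₁ ij)) (f (proj₂ ij)) (value l (mix f)))

  expand-nonneg : (∀ ij → 0ℚ ≤ u ij × 0ℚ ≤ v ij) → ∀ l → NonNegativeWeights l → NonNegativeWeights (expand l)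
  expand-nonneg 0≤uv ((w , ij) ∷ l) 0≤l zero          = 0≤-* (0≤l zero) (proj₁ (0≤uv ij))
  expand-nonneg 0≤uv ((w , ij) ∷ l) 0≤l (suc zero)    = 0≤-* (0≤l zero) (proj₂ (0≤uv ij))
  expand-nonneg 0≤uv ((w , ij) ∷ l) 0≤l (suc (suc j)) = expand-nonneg 0≤uv l (λ j → 0≤l (suc j)) j

IsCertificate : ∀ {X d} → (X → Point d) → Certificate X → Set
IsCertificate {d = d} a l = length l ≡ 2 ℕ.^ d × NonNegativeWeights l × Annihilates l a

-- Each eliminated variable doubles the number of rows that are combined.
fourier-motzkin : ∀ d {X : Set} (xs : List X) (a : X → Point d) →
  Σ (List (Certificate X)) λ L → All (IsCertificate a) L ×
    (∀ b → All (λ l → 0ℚ ≤ value l b) L → ∃ λ x → ∀ {i} → i List.∈ xs → ⟨ a i , x ⟩ ≤ b i)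
fourier-motzkin zero xs a = List.map single xs , All.map⁺ (All.universal certified xs) , feasible
  where
  single : _ → _
  single i = (1ℚ , i) ∷ []

  certified : ∀ i → IsCertificate a (single i)
  certified i = refl , (λ { zero → 0≤1 }) , λ ()

  feasible : ∀ b → _ → _
  feasible b ok = (λ ()) , λ {i} i∈ → subst (0ℚ ≤_)
    (solve 1 (λ b → con 1ℚ :* b :+ con 0ℚ := b) refl (b i)) (All.lookup (All.map⁻ ok) i∈)
fourier-motzkin (suc d) {X} xs a = List.map expand L , All.map⁺ (All.map (λ {l} → certified′ l) certified) , feasible′
  where
  α : X → ℚ
  α i = head (a i)

  u v : X × X → ℚ
  u (i , j) = proj₁ (elimination (α i) (α j))
  v (i , j) = proj₂ (elimination (α i) (α j))

  open Expansion u v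

  reduced : X × X → Point d
  reduced ij k = mix (λ i → a i (suc k)) ij

  recursive = fourier-motzkin d (cartesianProduct xs xs) reduced
  L         = proj₁ recursive
  certified = proj₁ (proj₂ recursive)
  feasible  = proj₂ (proj₂ recursive)

  certified′ : ∀ l → IsCertificate reduced l → IsCertificate a (expand l)
  certified′ l (len , 0≤l , ann) = trans (length-expand l) (cong (2 ℕ.*_) len) ,
    expand-nonneg (λ (i , j) → elimination-nonneg (α i) (α j)) l 0≤l ,
    λ { zero    → trans (value-expand l α) (value-zero l _ (λ (i , j) → elimination-cancels (α i) (α j)))
      ; (suc k) → trans (value-expand l (λ i → a i (suc k))) (ann k) }

  feasible′ : ∀ b → All (λ l → 0ℚ ≤ value l b) (List.map expand L) → ∃ λ x → ∀ {i} → i List.∈ xs → ⟨ a i , x ⟩ ≤ b i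
  feasible′ b ok = x₀ Vector.∷ x′ , λ {i} i∈ →
    ≤-via (r i - α i * x₀) (p≤q⇒0≤q-p (x₀-ok i∈))
      (solve 3 (λ b p q → b :- (p :+ q) := b :- q :- p) refl (b i) (α i * x₀) ⟨ tail (a i) , x′ ⟩)
    where
    reduced-solution = feasible (mix b) (All.map (λ {l} → subst (0ℚ ≤_) (value-expand l b)) (All.map⁻ ok))
    x′ = proj₁ reduced-solution

    r : X → ℚ
    r i = b i - ⟨ tail (a i) , x′ ⟩

    mix-⟨,⟩ : ∀ ij → ⟨ reduced ij , x′ ⟩ ≡ mix (λ i → ⟨ tail (a i) , x′ ⟩) ij
    mix-⟨,⟩ ij@(i , j) = begin
      sum (λ k → (u ij * a i (suc k) + v ij * a j (suc k)) * x′ k)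
        ≡⟨ sum-cong-≗ (λ k → solve 5 (λ u v p q x → (u :* p :+ v :* q) :* x := u :* (p :* x) :+ v :* (q :* x)) refl
             (u ij) (v ij) (a i (suc k)) (a j (suc k)) (x′ k)) ⟩
      sum (λ k → u ij * (a i (suc k) * x′ k) + v ij * (a j (suc k) * x′ k))
        ≡⟨ ∑-distrib-+ (λ k → u ij * (a i (suc k) * x′ k)) (λ k → v ij * (a j (suc k) * x′ k)) ⟩
      sum (λ k → u ij * (a i (suc k) * x′ k)) + sum (λ k → v ij * (a j (suc k) * x′ k))
        ≡⟨ cong₂ _+_ (sum-*ˡ (u ij) (λ k → a i (suc k) * x′ k)) (sum-*ˡ (v ij) (λ k → a j (suc k) * x′ k)) ⟩
      mix (λ i → ⟨ tail (a i) , x′ ⟩) ij ∎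
      where open ≡-Reasoning

    mix-r : ∀ {i j} → i List.∈ xs → j List.∈ xs → 0ℚ ≤ mix r (i , j)
    mix-r {i} {j} i∈ j∈ = subst (0ℚ ≤_)
      (trans (cong (λ z → mix b (i , j) - z) (mix-⟨,⟩ (i , j)))
        (solve 6 (λ u v b c p q → (u :* b :+ v :* c) :- (u :* p :+ v :* q) := u :* (b :- p) :+ v :* (c :- q)) refl
          (u (i , j)) (v (i , j)) (b i) (b j) ⟨ tail (a i) , x′ ⟩ ⟨ tail (a j) , x′ ⟩))
      (p≤q⇒0≤q-p (proj₂ reduced-solution (∈-cartesianProduct⁺ i∈ j∈)))

    -- A row free of the eliminated variable is recovered from its pair with itself, where
    -- `elimination` gives the weights 1 and 0.
    last-variable = one-variable xs α r
      (λ {i} i∈ αi≡0 → subst (0ℚ ≤_)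
        (trans (cong (λ e → proj₁ e * r i + proj₂ e * r i) (elimination-≡0 (α i) (α i) αi≡0))
          (solve 1 (λ r → con 1ℚ :* r :+ con 0ℚ :* r := r) refl (r i)))
        (mix-r i∈ i∈))
      (λ {i} {j} i∈ j∈ 0<αi αj<0 → subst (0ℚ ≤_)
        (cong (λ e → proj₁ e * r i + proj₂ e * r j) (elimination-pair (α i) (α j) 0<αi αj<0))
        (mix-r i∈ j∈))
    x₀ = proj₁ last-variable
    x₀-ok = proj₂ last-variable

-- Linear programming duality

slack-step : ∀ {c W B} → c * W ≤ B → ¬ (0ℚ < W × B ≡ c * W) →
  ∃ λ ε → 0ℚ < ε × (∀ s → 0ℚ ≤ s → s ≤ ε → (c + s) * W ≤ B)
slack-step {c} {W} {B} cW≤B not-tight with 0ℚ <? W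
-- For `W ≤ 0` raising `c` can only decrease the left-hand side, so the choice of 1 is arbitrary.
... | no W≯0 = 1ℚ , 0<1 , λ s 0≤s _ → ≤-via (s * - W + (B - c * W))
  (0≤-+ (0≤-* 0≤s (p≤0⇒0≤-p (≮⇒≥ W≯0))) (p≤q⇒0≤q-p cW≤B))
  (solve 4 (λ B c s W → B :- (c :+ s) :* W := s :* (:- W) :+ (B :- c :* W)) refl B c s W)
... | yes 0<W = ε , 0<-* 0<ω 0<gap , λ s _ s≤ε → ≤-via ((ε - s) * W) (0≤-* (p≤q⇒0≤q-p s≤ε) (<⇒≤ 0<W)) (eq s)
  where
  ω = proj₁ (reciprocal 0<W)
  0<ω = proj₁ (proj₂ (reciprocal 0<W))
  ωW≡1 = proj₂ (proj₂ (reciprocal 0<W))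
  0<gap : 0ℚ < B - c * W
  0<gap = p<q⇒0<q-p (≰⇒> (λ B≤cW → not-tight (0<W , ≤-antisym B≤cW cW≤B)))
  -- The increase of `c` at which the inequality becomes an equality.
  ε = ω * (B - c * W)
  eq : ∀ s → B - (c + s) * W ≡ (ε - s) * W
  eq s = sym (trans (solve 5 (λ o B c s W → (o :* (B :- c :* W) :- s) :* W := (o :* W) :* (B :- c :* W) :- s :* W) refl ω B c s W)
    (trans (cong (λ z → z * (B - c * W) - s * W) ωW≡1)
      (solve 4 (λ B c s W → con 1ℚ :* (B :- c :* W) :- s :* W := B :- (c :+ s) :* W) refl B c s W)))

ε-min : ∀ {P Q : ℚ → Set} →
  (∃ λ ε → 0ℚ < ε × (∀ s → 0ℚ ≤ s → s ≤ ε → P s)) →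
  (∃ λ ε → 0ℚ < ε × (∀ s → 0ℚ ≤ s → s ≤ ε → Q s)) →
  ∃ λ ε → 0ℚ < ε × (∀ s → 0ℚ ≤ s → s ≤ ε → P s × Q s)
ε-min (ε₁ , 0<ε₁ , ok₁) (ε₂ , 0<ε₂ , ok₂) with ≤-total ε₁ ε₂
... | inj₁ ε₁≤ε₂ = ε₁ , 0<ε₁ , λ s 0≤s s≤ε → ok₁ s 0≤s s≤ε , ok₂ s 0≤s (≤-trans s≤ε ε₁≤ε₂)
... | inj₂ ε₂≤ε₁ = ε₂ , 0<ε₂ , λ s 0≤s s≤ε → ok₁ s 0≤s (≤-trans s≤ε ε₂≤ε₁) , ok₂ s 0≤s s≤ε

module _ {n d} (a : Vector (Point d) n) (b w : Vector ℚ n) (c : ℚ) where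

  Tight : Certificate (Fin n) → Set
  Tight l = 0ℚ < value l w × value l b ≡ c * value l w

  tight? : ∀ l → Dec (Tight l)
  tight? l = (0ℚ <? value l w) ×-dec (value l b ≟ c * value l w)

  value-shift : ∀ t l → value l (λ i → b i - t * w i) ≡ value l b - t * value l w
  value-shift t l = trans (value-sub l b (λ i → t * w i)) (cong (λ z → value l b - z) (value-*ˡ l t w))

  certificate-holds : ∀ x → (∀ i → ⟨ a i , x ⟩ ≤ b i - c * w i) → ∀ l → IsCertificate a l → c * value l w ≤ value l b
  certificate-holds x feasible l (_ , 0≤l , ann) = ≤-via (value l (λ i → b i - c * w i))
    (subst (_≤ value l (λ i → b i - c * w i)) (annihilates-⟨,⟩ l a ann x)
      (value-mono l 0≤l (λ i → ⟨ a i , x ⟩) (λ i → b i - c * w i) feasible))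
    (sym (value-shift c l))

  slack : ∀ L → All (λ l → c * value l w ≤ value l b) L → All (λ l → ¬ Tight l) L →
    ∃ λ ε → 0ℚ < ε × (∀ s → 0ℚ ≤ s → s ≤ ε → All (λ l → (c + s) * value l w ≤ value l b) L)
  slack []      []         []         = 1ℚ , 0<1 , λ _ _ _ → []
  slack (l ∷ L) (le ∷ les) (nt ∷ nts) = map₂ (map₂ (λ ok s 0≤s s≤ε → proj₁ (ok s 0≤s s≤ε) ∷ proj₂ (ok s 0≤s s≤ε)))
    (ε-min (slack-step {c} {value l w} {value l b} le nt) (slack L les nts))

  -- The certificates depend on the left-hand sides only, so one finite list `L` tests feasibility
  -- for all `t` at once. If none were tight at `c`, a common slack would allow `c` to be raised,
  -- against optimality. The weights `w` serve two programs: all ones for the adjoint polytopes, and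
  -- `δ zero` for the support function in `dual-solution`.
  lp-duality : ∀ (x₀ : Point d) → (∀ i → ⟨ a i , x₀ ⟩ ≤ b i - c * w i) →
    (∀ t x → (∀ i → ⟨ a i , x ⟩ ≤ b i - t * w i) → t ≤ c) →
    ∃ λ l → IsCertificate a l × 0ℚ < value l w × value l b ≡ c * value l w
  lp-duality x₀ feasible-at-c infeasible = search (Any.any? tight? L)
    where
    elimination-result = fourier-motzkin d (allFin n) a
    L         = proj₁ elimination-result
    certified = proj₁ (proj₂ elimination-result)
    feasible  = proj₂ (proj₂ elimination-result)

    absurd : ∀ ε → 0ℚ < ε → All (λ l → (c + ε) * value l w ≤ value l b) L → ⊥
    absurd ε 0<ε ok = <-irrefl refl (<-≤-trans (<-via ε 0<ε (solve 2 (λ c e → c :+ e :- c := e) refl c ε))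
      (infeasible (c + ε) (proj₁ solution) (λ i → proj₂ solution (∈-allFin i))))
      where
      solution = feasible (λ i → b i - (c + ε) * w i)
        (All.map (λ {l} le → subst (0ℚ ≤_) (sym (value-shift (c + ε) l)) (p≤q⇒0≤q-p le)) ok)

    search : Dec (Any.Any Tight L) → ∃ λ l → IsCertificate a l × Tight l
    search (yes found) = let l , l∈L , tight = find found in l , All.lookup certified l∈L , tight
    search (no none)   =
      let ε , 0<ε , ok = slack L (All.map (λ {l} → certificate-holds x₀ feasible-at-c l) certified) (All.¬Any⇒All¬ L none)
      in ⊥-elim (absurd ε 0<ε (ok ε (<⇒≤ 0<ε) ≤-refl))

-- Simultaneous approximation

toℚᵘ-/1 : ∀ i → toℚᵘ (i / 1) ℚᵘ.≃ ℚᵘ.mkℚᵘ i 0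
toℚᵘ-/1 i = toℚᵘ-fromℚᵘ (ℚᵘ.mkℚᵘ i 0)

/1-+ : ∀ i j → (i ℤ.+ j) / 1 ≡ i / 1 + j / 1
/1-+ i j = toℚᵘ-injective (begin
  toℚᵘ ((i ℤ.+ j) / 1)                ≈⟨ toℚᵘ-/1 (i ℤ.+ j) ⟩
  ℚᵘ.mkℚᵘ (i ℤ.+ j) 0                  ≈⟨ ℚᵘ.*≡* (cong (ℤ._* ℤ.+ 1) (sym (cong₂ ℤ._+_ (ℤ.*-identityʳ i) (ℤ.*-identityʳ j)))) ⟩
  ℚᵘ.mkℚᵘ i 0 ℚᵘ.+ ℚᵘ.mkℚᵘ j 0         ≈⟨ ℚᵘ.+-cong (toℚᵘ-/1 i) (toℚᵘ-/1 j) ⟨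
  toℚᵘ (i / 1) ℚᵘ.+ toℚᵘ (j / 1)       ≈⟨ toℚᵘ-homo-+ (i / 1) (j / 1) ⟨
  toℚᵘ (i / 1 + j / 1)                ∎)
  where open ℚᵘ.≃-Reasoning

/1-* : ∀ i j → (i ℤ.* j) / 1 ≡ (i / 1) * (j / 1)
/1-* i j = toℚᵘ-injective (begin
  toℚᵘ ((i ℤ.* j) / 1)                ≈⟨ toℚᵘ-/1 (i ℤ.* j) ⟩
  ℚᵘ.mkℚᵘ i 0 ℚᵘ.* ℚᵘ.mkℚᵘ j 0         ≈⟨ ℚᵘ.*-cong (toℚᵘ-/1 i) (toℚᵘ-/1 j) ⟨
  toℚᵘ (i / 1) ℚᵘ.* toℚᵘ (j / 1)       ≈⟨ toℚᵘ-homo-* (i / 1) (j / 1) ⟨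
  toℚᵘ ((i / 1) * (j / 1))            ∎)
  where open ℚᵘ.≃-Reasoning

/1-cancel-≤ : ∀ i j → i / 1 ≤ j / 1 → i ℤ.≤ j
/1-cancel-≤ i j le = subst₂ ℤ._≤_ (ℤ.*-identityʳ i) (ℤ.*-identityʳ j)
  (ℚᵘ.drop-*≤* (ℚᵘ.≤-respˡ-≃ (toℚᵘ-/1 i) (ℚᵘ.≤-respʳ-≃ (toℚᵘ-/1 j) (toℚᵘ-mono-≤ le))))

/1-mono-≤ : ∀ i j → i ℤ.≤ j → i / 1 ≤ j / 1
/1-mono-≤ i j le = toℚᵘ-cancel-≤ (ℚᵘ.≤-respˡ-≃ (ℚᵘ.≃-sym (toℚᵘ-/1 i)) (ℚᵘ.≤-respʳ-≃ (ℚᵘ.≃-sym (toℚᵘ-/1 j))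
  (ℚᵘ.*≤* (subst₂ ℤ._≤_ (sym (ℤ.*-identityʳ i)) (sym (ℤ.*-identityʳ j)) le))))

opaque
  ι : ℕ → ℚ
  ι n = ℤ.+ n / 1

  ι-+ : ∀ m n → ι (m ℕ.+ n) ≡ ι m + ι n
  ι-+ m n = /1-+ (ℤ.+ m) (ℤ.+ n)

  ι-* : ∀ m n → ι (m ℕ.* n) ≡ ι m * ι n
  ι-* m n = trans (cong (_/ 1) (ℤ.pos-* m n)) (/1-* (ℤ.+ m) (ℤ.+ n))

  ι-suc : ∀ n → ι (suc n) ≡ 1ℚ + ι n
  ι-suc n = ι-+ 1 n

  ι-mono : ∀ {m n} → m ℕ.≤ n → ι m ≤ ι n
  ι-mono m≤n = /1-mono-≤ _ _ (ℤ.+≤+ m≤n)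

  ι-cancel : ∀ {m n} → ι m ≤ ι n → m ℕ.≤ n
  ι-cancel {m} {n} le = ℤ.drop‿+≤+ (/1-cancel-≤ (ℤ.+ m) (ℤ.+ n) le)

  ι-cancel-< : ∀ {m n} → ι m < ι n → m ℕ.< n
  ι-cancel-< {m} {n} lt with m ℕ.<? n
  ... | yes m<n = m<n
  ... | no m≮n = contradiction (<-≤-trans lt (ι-mono (ℕ.≮⇒≥ m≮n))) (<-irrefl refl)

  0≤ι : ∀ n → 0ℚ ≤ ι n
  0≤ι n = ι-mono {0} {n} z≤n

  0<ι : ∀ {n} → 1 ℕ.≤ n → 0ℚ < ι n
  0<ι {n} 1≤n = <-≤-trans 0<1 (ι-mono {1} {n} 1≤n)

  ι-zero : ι 0 ≡ 0ℚ
  ι-zero = refl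

  ι-def : ∀ n → ι n ≡ (ℤ.+ n) / 1
  ι-def n = refl

ι-sum : ∀ {k} (p : Vector ℕ k) → ∃ λ D → ι D ≡ sum (λ j → ι (p j))
ι-sum {zero}  p = 0 , ι-zero
ι-sum {suc k} p = map (p zero ℕ.+_) (λ {D} eq → trans (ι-+ (p zero) D) (cong (ι (p zero) +_) eq)) (ι-sum (p ∘ suc))

archimedean : ∀ x → ∃ λ n → x ≤ ι n
-- The denominator is at least 1, so the absolute value of the numerator suffices.
archimedean x = ℤ.∣ ↥ x ∣ , toℚᵘ-cancel-≤ (subst (λ z → toℚᵘ x ℚᵘ.≤ toℚᵘ z) (sym (ι-def ℤ.∣ ↥ x ∣))
  (ℚᵘ.≤-respʳ-≃ (ℚᵘ.≃-sym (toℚᵘ-/1 (ℤ.+ ℤ.∣ ↥ x ∣))) (bound x)))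
  where
  bound : ∀ x → toℚᵘ x ℚᵘ.≤ ℚᵘ.mkℚᵘ (ℤ.+ ℤ.∣ ↥ x ∣) 0
  bound (mkℚ (ℤ.+ n)    d _) = ℚᵘ.*≤* (subst₂ ℤ._≤_ (sym (ℤ.*-identityʳ (ℤ.+ n))) (ℤ.pos-* n (suc d)) (ℤ.+≤+ (ℕ.m≤m*n n (suc d))))
  bound (mkℚ -[1+ n ] d _) = ℚᵘ.*≤* ℤ.-≤+

floor′ : ∀ n x → 0ℚ ≤ x → x < ι n → ∃ λ f → ι f ≤ x × x < 1ℚ + ι f
floor′ zero    x 0≤x x<0 = contradiction (≤-<-trans 0≤x (subst (x <_) ι-zero x<0)) (<-irrefl refl)
floor′ (suc n) x 0≤x x<n with x <? ι n
... | yes x<n′ = floor′ n x 0≤x x<n′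
... | no x≮n   = n , ≮⇒≥ x≮n , subst (x <_) (ι-suc n) x<n

⌊⌋ : ∀ x → 0ℚ ≤ x → ∃ λ f → ι f ≤ x × x < 1ℚ + ι f
⌊⌋ x 0≤x = let n , x≤n = archimedean x in floor′ (suc n) x 0≤x
  (≤-<-trans x≤n (<-via 1ℚ 0<1 (trans (cong (_- ι n) (ι-suc n)) (solve 1 (λ p → con 1ℚ :+ p :- p := con 1ℚ) refl (ι n)))))

⌊⌋-mono : ∀ {x y f g} → x ≤ y → ι f ≤ x → y < 1ℚ + ι g → f ℕ.≤ g
⌊⌋-mono {x} {y} {f} {g} x≤y f≤x y<1+g = ℕ.s≤s⁻¹ (ι-cancel-< (subst (ι f <_) (sym (ι-suc g)) (≤-<-trans f≤x (≤-<-trans x≤y y<1+g))))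

same-remainder : ∀ {f g} N .{{_ : ℕ.NonZero N}} → f ℕ.≤ g → f ℕ.% N ≡ g ℕ.% N → ∃ λ p → g ≡ p ℕ.* N ℕ.+ f
same-remainder {f} {g} N f≤g eq = g ℕ./ N ℕ.∸ f ℕ./ N , (begin
  g                                                         ≡⟨ ℕ.m≡m%n+[m/n]*n g N ⟩
  g ℕ.% N ℕ.+ g ℕ./ N ℕ.* N                                   ≡⟨ cong₂ ℕ._+_ (sym eq) (cong (ℕ._* N) (sym (ℕ.m∸n+n≡m (ℕ./-monoˡ-≤ N f≤g)))) ⟩
  f ℕ.% N ℕ.+ (p ℕ.+ f ℕ./ N) ℕ.* N                             ≡⟨ cong (f ℕ.% N ℕ.+_) (ℕ.*-distribʳ-+ N p (f ℕ./ N)) ⟩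
  f ℕ.% N ℕ.+ (p ℕ.* N ℕ.+ f ℕ./ N ℕ.* N)                       ≡⟨ ℕ.+-comm (f ℕ.% N) _ ⟩
  p ℕ.* N ℕ.+ f ℕ./ N ℕ.* N ℕ.+ f ℕ.% N                         ≡⟨ ℕ.+-assoc (p ℕ.* N) _ _ ⟩
  p ℕ.* N ℕ.+ (f ℕ./ N ℕ.* N ℕ.+ f ℕ.% N)                       ≡⟨ cong (p ℕ.* N ℕ.+_) (ℕ.+-comm (f ℕ./ N ℕ.* N) _) ⟩
  p ℕ.* N ℕ.+ (f ℕ.% N ℕ.+ f ℕ./ N ℕ.* N)                       ≡⟨ cong (p ℕ.* N ℕ.+_) (ℕ.m≡m%n+[m/n]*n f N) ⟨
  p ℕ.* N ℕ.+ f                                               ∎)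
  where
  open ≡-Reasoning
  p = g ℕ./ N ℕ.∸ f ℕ./ N

module Dirichlet {K} (N : ℕ) .{{_ : ℕ.NonZero N}} (x : Vector ℚ K) (0≤x : ∀ j → 0ℚ ≤ x j) where

  private
    y : ℕ → Fin K → ℚ
    y m j = ι N * ι m * x j

    0≤y : ∀ m j → 0ℚ ≤ y m j
    0≤y m j = 0≤-* (0≤-* (0≤ι N) (0≤ι m)) (0≤x j)

    f : ℕ → Fin K → ℕ
    f m j = proj₁ (⌊⌋ (y m j) (0≤y m j))

    f≤y : ∀ m j → ι (f m j) ≤ y m j
    f≤y m j = proj₁ (proj₂ (⌊⌋ (y m j) (0≤y m j)))

    y<1+f : ∀ m j → y m j < 1ℚ + ι (f m j)
    y<1+f m j = proj₂ (proj₂ (⌊⌋ (y m j) (0≤y m j)))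

    -- The remainder of `⌊N m xⱼ⌋` modulo `N` names the subinterval, among `N` of length 1/N, that
    -- contains the fractional part of `m xⱼ`.
    box : ℕ → Fin K → Fin N
    box m j = fromℕ< (ℕ.m%n<n (f m j) N)

    -- The distance of `m xⱼ` from `p` is at most 1/N, multiplied by `N`.
    Close : ℕ → ℕ → Fin K → Set
    Close m p j = ι N * ι p ≤ y m j + 1ℚ × y m j ≤ ι N * ι p + 1ℚ

    same-box⇒same-remainder : ∀ m₁ m₂ → funToFin (box m₁) ≡ funToFin (box m₂) → ∀ j → f m₁ j ℕ.% N ≡ f m₂ j ℕ.% N
    same-box⇒same-remainder m₁ m₂ eq j = begin
      f m₁ j ℕ.% N                              ≡⟨ toℕ-fromℕ< (ℕ.m%n<n (f m₁ j) N) ⟨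
      toℕ (box m₁ j)                           ≡⟨ cong toℕ (finToFun-funToFin (box m₁) j) ⟨
      toℕ (finToFun (funToFin (box m₁)) j)     ≡⟨ cong (λ z → toℕ (finToFun {N} {K} z j)) eq ⟩
      toℕ (finToFun (funToFin (box m₂)) j)     ≡⟨ cong toℕ (finToFun-funToFin (box m₂) j) ⟩
      toℕ (box m₂ j)                           ≡⟨ toℕ-fromℕ< (ℕ.m%n<n (f m₂ j) N) ⟩
      f m₂ j ℕ.% N                              ∎
      where open ≡-Reasoning

    -- Equal remainders make the difference of the two floors a multiple of `N`, and this difference
    -- misses `y m j` by at most 1. Since `x` is nonnegative the floors are monotone, so `p` is a
    -- natural number.
    same-box⇒close : ∀ m m₁ m₂ → ι m₂ ≡ ι m + ι m₁ → ∀ j → f m₁ j ℕ.% N ≡ f m₂ j ℕ.% N → ∃ λ p → Close m p j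
    same-box⇒close m m₁ m₂ ιm₂ j same = p ,
      ≤-via ((y m₂ j - ι (f m₂ j)) + (1ℚ + ι (f m₁ j) - y m₁ j))
        (0≤-+ (p≤q⇒0≤q-p (f≤y m₂ j)) (p≤q⇒0≤q-p (<⇒≤ (y<1+f m₁ j))))
        (sym (trans (cong₂ (λ s t → (s - t) + (1ℚ + ι (f m₁ j) - y m₁ j)) y-diff ιf₂)
          (solve 4 (λ a b c e → (a :+ b :- (c :+ e)) :+ (con 1ℚ :+ e :- b) := a :+ con 1ℚ :- c) refl
            (y m j) (y m₁ j) (ι N * ι p) (ι (f m₁ j))))) ,
      ≤-via ((1ℚ + ι (f m₂ j) - y m₂ j) + (y m₁ j - ι (f m₁ j)))
        (0≤-+ (p≤q⇒0≤q-p (<⇒≤ (y<1+f m₂ j))) (p≤q⇒0≤q-p (f≤y m₁ j)))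
        (sym (trans (cong₂ (λ s t → (1ℚ + t - s) + (y m₁ j - ι (f m₁ j))) y-diff ιf₂)
          (solve 4 (λ a b c e → (con 1ℚ :+ (c :+ e) :- (a :+ b)) :+ (b :- e) := c :+ con 1ℚ :- a) refl
            (y m j) (y m₁ j) (ι N * ι p) (ι (f m₁ j)))))
      where
      y-diff : y m₂ j ≡ y m j + y m₁ j
      y-diff = trans (cong (λ z → ι N * z * x j) ιm₂)
        (solve 4 (λ N m n x → N :* (m :+ n) :* x := N :* m :* x :+ N :* n :* x) refl (ι N) (ι m) (ι m₁) (x j))

      f-mono : f m₁ j ℕ.≤ f m₂ j
      f-mono = ⌊⌋-mono {y m₁ j} {y m₂ j} (≤-via (y m j) (0≤y m j) (trans (cong (_- y m₁ j) y-diff)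
        (solve 2 (λ a b → a :+ b :- b := a) refl (y m j) (y m₁ j)))) (f≤y m₁ j) (y<1+f m₂ j)

      split : ∃ λ p → f m₂ j ≡ p ℕ.* N ℕ.+ f m₁ j
      split = same-remainder N f-mono same

      p : ℕ
      p = proj₁ split

      ιf₂ : ι (f m₂ j) ≡ ι N * ι p + ι (f m₁ j)
      ιf₂ = trans (cong ι (proj₂ split)) (trans (ι-+ (p ℕ.* N) (f m₁ j))
        (cong (_+ ι (f m₁ j)) (trans (ι-* p N) (*-comm (ι p) (ι N)))))

    Simultaneous : Set
    Simultaneous = ∃₂ λ m (p : Vector ℕ K) → 1 ℕ.≤ m × m ℕ.≤ N ℕ.^ K × (∀ j → Close m (p j) j)

    collision⇒approximation : (∃₂ λ (i j : Fin (suc (N ℕ.^ K))) → i Fin.< j × funToFin (box (toℕ i)) ≡ funToFin (box (toℕ j))) → Simultaneous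
    collision⇒approximation (i₁ , i₂ , i₁<i₂ , eq) = m , (λ j → proj₁ (close j)) , ℕ.m<n⇒0<n∸m i₁<i₂ ,
      ℕ.≤-trans (ℕ.m∸n≤m (toℕ i₂) (toℕ i₁)) (ℕ.s≤s⁻¹ (toℕ<n i₂)) , (λ j → proj₂ (close j))
      where
      m = toℕ i₂ ℕ.∸ toℕ i₁
      close : ∀ j → ∃ λ p → Close m p j
      close j = same-box⇒close m (toℕ i₁) (toℕ i₂)
        (trans (cong ι (sym (ℕ.m∸n+n≡m (ℕ.<⇒≤ i₁<i₂)))) (ι-+ m (toℕ i₁))) j
        (same-box⇒same-remainder (toℕ i₁) (toℕ i₂) eq j)

  dirichlet : ∃₂ λ m (p : Vector ℕ K) → 1 ℕ.≤ m × m ℕ.≤ N ℕ.^ K ×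
    (∀ j → ι N * ι (p j) ≤ ι N * ι m * x j + 1ℚ × ι N * ι m * x j ≤ ι N * ι (p j) + 1ℚ)
  -- The multiples 0, ..., N^K are one more than the N^K boxes, so the difference of two colliding
  -- ones lies between 1 and N^K.
  dirichlet = collision⇒approximation (pigeonhole (ℕ.n<1+n (N ℕ.^ K)) (λ i → funToFin (box (toℕ i))))

open Dirichlet using (dirichlet)

-- Approximation with nonnegative remainders

sum-const : ∀ k r → sum {k} (λ _ → r) ≡ ι k * r
sum-const zero    r = sym (trans (cong (_* r) ι-zero) (*-zeroˡ r))
sum-const (suc k) r = trans (cong (r +_) (sum-const k r)) (sym (trans (cong (_* r) (ι-suc k))
  (solve 2 (λ k r → (con 1ℚ :+ k) :* r := r :+ k :* r) refl (ι k) r)))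

-- When `sum x ≡ 1ℚ`, the remainders `(ι D + α) * x j - ι (p j)` are nonnegative and add up to
-- exactly `α`. The bound `1≤D` excludes the trivial choice `p = 0`.
record Approximation {K} (α : ℚ) (B : ℕ) (x : Vector ℚ K) : Set where
  constructor approximation
  field
    p     : Vector ℕ K
    D     : ℕ
    ιD    : ι D ≡ sum (λ j → ι (p j))
    1≤D   : 1 ℕ.≤ D
    D≤B   : D ℕ.≤ B
    below : ∀ j → ι (p j) ≤ (ι D + α) * x j

punchIn-elim : ∀ {n} (P : Fin (suc n) → Set) j → P j → (∀ i → P (punchIn j i)) → ∀ i → P i
punchIn-elim P j Pj Prest i with j Fin.≟ i
... | yes refl = Pj
... | no j≢i   = subst P (punchIn-punchOut j≢i) (Prest (punchOut j≢i))

-- A negligible coordinate is dropped after rescaling the others to sum 1.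
drop-coordinate : ∀ {K} α η B B′ → 0ℚ < α → B ℕ.≤ B′ → η * (ι B + α) ≡ ½ * α →
  (∀ (x : Vector ℚ K) → (∀ j → 0ℚ ≤ x j) → sum x ≡ 1ℚ → Approximation (½ * α) B x) →
  ∀ (x : Vector ℚ (suc K)) → (∀ j → 0ℚ ≤ x j) → sum x ≡ 1ℚ → ∀ j → x j < η → Approximation α B′ x
drop-coordinate {K} α η B B′ 0<α B≤B′ ηeq recurse x 0≤x Σx≡1 j xj<η = approximation
  p D (trans IH.ιD (sym Σp)) IH.1≤D (ℕ.≤-trans IH.D≤B B≤B′) below
  where
  s : ℚ
  s = sum (removeAt x j)

  xj+s≡1 : x j + s ≡ 1ℚ
  xj+s≡1 = trans (sym (sum-remove {i = j} x)) Σx≡1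

  0<½α : 0ℚ < ½ * α
  0<½α = 0<-* (positive⁻¹ ½) 0<α

  0<B+α : 0ℚ < ι B + α
  0<B+α = subst (0ℚ <_) (+-comm α (ι B)) (0<-+ 0<α (0≤ι B))

  η<1 : 0ℚ < 1ℚ - η
  η<1 = 0<-*⁻ 0<B+α (subst (0ℚ <_)
    (trans (cong (λ z → z + (ι B + ½ * α)) (sym (+-inverseʳ (½ * α))))
     (trans (cong (λ z → (½ * α - z) + (ι B + ½ * α)) (sym ηeq))
      (solve 3 (λ B a e → (con ½ :* a :- e :* (B :+ a)) :+ (B :+ con ½ :* a) := (B :+ a) :* (con 1ℚ :- e)) refl (ι B) α η)))
    (subst (0ℚ <_) (trans (+-comm (½ * α) (ι B)) (sym (+-identityˡ (ι B + ½ * α)))) (0<-+ 0<½α (0≤ι B))))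

  0<s : 0ℚ < s
  0<s = subst (0ℚ <_)
    (trans (cong (λ z → (z - η) + (η - x j)) (sym xj+s≡1))
      (solve 3 (λ x s e → (x :+ s :- e) :+ (e :- x) := s) refl (x j) s η))
    (0<-+ η<1 (<⇒≤ (p<q⇒0<q-p xj<η)))

  r = proj₁ (reciprocal 0<s)
  0<r = proj₁ (proj₂ (reciprocal 0<s))
  rs≡1 : r * s ≡ 1ℚ
  rs≡1 = proj₂ (proj₂ (reciprocal 0<s))

  x′ : Vector ℚ K
  x′ i = r * x (punchIn j i)

  module IH = Approximation (recurse x′ (λ i → 0≤-* (<⇒≤ 0<r) (0≤x (punchIn j i))) (trans (sum-*ˡ r (removeAt x j)) rs≡1))
  D = IH.D
  p = insertAt IH.p j 0

  Σp : sum (λ i → ι (p i)) ≡ sum (λ i → ι (IH.p i))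
  Σp = trans (sum-remove {i = j} (λ i → ι (p i))) (trans
    (cong₂ _+_ (trans (cong ι (insertAt-lookup IH.p j 0)) ι-zero) (sum-cong-≗ (λ i → cong ι (insertAt-punchIn IH.p j 0 i))))
    (+-identityˡ _))

  0≤D+α : 0ℚ ≤ ι D + α
  0≤D+α = 0≤-+ (0≤ι D) (<⇒≤ 0<α)

  -- Dropping coordinate `j` costs `(ι D + α) * x j`, which is at most `η * (ι B + α) = ½ * α`
  -- because `D ≤ B`. This is the half of `α` withheld from the recursive call.
  gain : 0ℚ ≤ (ι D + α) * s - (ι D + ½ * α)
  gain = subst (0ℚ ≤_)
    (trans (cong (λ z → (η - x j) * (ι D + α) + η * (ι B - ι D) + (½ * α - z)) ηeq)
     (trans (solve 5 (λ e x D B a → (e :- x) :* (D :+ a) :+ e :* (B :- D) :+ (con ½ :* a :- con ½ :* a)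
                 := (e :* (B :+ a) :- x :* (D :+ a)) ) refl η (x j) (ι D) (ι B) α)
     (trans (cong (_- x j * (ι D + α)) ηeq)
     (trans (solve 3 (λ a x D → con ½ :* a :- x :* (D :+ a) := (D :+ a) :* (con 1ℚ :- x) :- (D :+ con ½ :* a)) refl α (x j) (ι D))
     (cong (λ z → (ι D + α) * z - (ι D + ½ * α))
       (trans (cong (_- x j) (sym xj+s≡1)) (solve 2 (λ x s → x :+ s :- x := s) refl (x j) s)))))))
    (0≤-+ (0≤-+ (0≤-* (p≤q⇒0≤q-p (<⇒≤ xj<η)) 0≤D+α) (0≤-* 0≤η (p≤q⇒0≤q-p (ι-mono IH.D≤B))))
      (p≤q⇒0≤q-p (≤-reflexive ηeq)))
    where
    0≤η : 0ℚ ≤ η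
    0≤η = ≤-trans (0≤x j) (<⇒≤ xj<η)

  below-punchIn : ∀ i → ι (IH.p i) ≤ (ι D + α) * x (punchIn j i)
  below-punchIn i = ≤-via
    (((ι D + ½ * α) * x′ i - ι (IH.p i)) + ((ι D + α) * s - (ι D + ½ * α)) * x′ i)
    (0≤-+ (p≤q⇒0≤q-p (IH.below i)) (0≤-* gain (0≤-* (<⇒≤ 0<r) (0≤x (punchIn j i)))))
    (sym (trans
      (solve 6 (λ D a p s r x → ((D :+ con ½ :* a) :* (r :* x) :- p) :+ ((D :+ a) :* s :- (D :+ con ½ :* a)) :* (r :* x)
         := (r :* s) :* ((D :+ a) :* x) :- p) refl (ι D) α (ι (IH.p i)) s r (x (punchIn j i)))
      (cong (_- ι (IH.p i)) (trans (cong (_* ((ι D + α) * x (punchIn j i))) rs≡1) (*-identityˡ ((ι D + α) * x (punchIn j i)))))))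

  below : ∀ i → ι (p i) ≤ (ι D + α) * x i
  below = punchIn-elim (λ i → ι (p i) ≤ (ι D + α) * x i) j
    (subst (_≤ (ι D + α) * x j) (sym (trans (cong ι (insertAt-lookup IH.p j 0)) ι-zero)) (0≤-* 0≤D+α (0≤x j)))
    (λ i → subst (λ z → ι z ≤ (ι D + α) * x (punchIn j i)) (sym (insertAt-punchIn IH.p j 0 i)) (below-punchIn i))

-- The surplus `α * x j` absorbs two errors: 1/N from Dirichlet's theorem, and `x j` times k/N from
-- replacing `m` by `D`, as these differ by at most k/N. Since `ω * x j` is at least 1,
-- `ω + ι k ≤ α * ι N` is enough. The condition `suc k ≤ N` rules out `D = 0`.
large-coordinates : ∀ {k} α η ω N B′ → 0ℚ < η → ω * η ≡ 1ℚ → ω + ι k ≤ α * ι N → suc k ℕ.≤ N → N ℕ.^ k ℕ.+ k ℕ.≤ B′ →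
  ∀ (x : Vector ℚ k) → (∀ j → η ≤ x j) → sum x ≡ 1ℚ → Approximation α B′ x
large-coordinates {k} α η ω N@(suc _) B′ 0<η ωη≡1 N-large k<N B′-large x η≤x Σx≡1 = approximation
  p D ιD 1≤D (ℕ.≤-trans D≤m+k (ℕ.≤-trans (ℕ.+-monoˡ-≤ k m≤) B′-large)) below
  where
  0≤x : ∀ j → 0ℚ ≤ x j
  0≤x j = ≤-trans (<⇒≤ 0<η) (η≤x j)

  approx = dirichlet N x 0≤x
  m = proj₁ approx
  p = proj₁ (proj₂ approx)
  1≤m = proj₁ (proj₂ (proj₂ approx))
  m≤ = proj₁ (proj₂ (proj₂ (proj₂ approx)))
  close = proj₂ (proj₂ (proj₂ (proj₂ approx)))

  D = proj₁ (ι-sum p)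
  ιD : ι D ≡ sum (λ j → ι (p j))
  ιD = proj₂ (ι-sum p)

  Σ1 : sum {k} (λ _ → 1ℚ) ≡ ι k
  Σ1 = trans (sum-const k 1ℚ) (*-identityʳ (ι k))

  Σp+1 : sum (λ j → ι N * ι (p j) + 1ℚ) ≡ ι N * ι D + ι k
  Σp+1 = trans (∑-distrib-+ (λ j → ι N * ι (p j)) (λ _ → 1ℚ))
    (cong₂ _+_ (trans (sum-*ˡ (ι N) (λ j → ι (p j))) (cong (ι N *_) (sym ιD))) Σ1)

  Σmx : sum (λ j → ι N * ι m * x j) ≡ ι N * ι m
  Σmx = trans (sum-*ˡ (ι N * ι m) x) (trans (cong (ι N * ι m *_) Σx≡1) (*-identityʳ (ι N * ι m)))

  ND≤Nm+k : ι N * ι D ≤ ι N * ι m + ι k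
  ND≤Nm+k = subst₂ _≤_ (trans (sum-*ˡ (ι N) (λ j → ι (p j))) (cong (ι N *_) (sym ιD)))
    (trans (∑-distrib-+ (λ j → ι N * ι m * x j) (λ _ → 1ℚ)) (cong₂ _+_ Σmx Σ1))
    (sum-mono (λ j → ι N * ι (p j)) (λ j → ι N * ι m * x j + 1ℚ) (λ j → proj₁ (close j)))

  Nm≤ND+k : ι N * ι m ≤ ι N * ι D + ι k
  Nm≤ND+k = subst₂ _≤_ Σmx Σp+1
    (sum-mono (λ j → ι N * ι m * x j) (λ j → ι N * ι (p j) + 1ℚ) (λ j → proj₂ (close j)))

  toℕ-≤ : ∀ {u v} → ι N * ι u ≤ ι N * ι v + ι k → N ℕ.* u ℕ.≤ N ℕ.* v ℕ.+ k
  toℕ-≤ {u} {v} le = ι-cancel (subst₂ _≤_ (sym (ι-* N u)) (sym (trans (ι-+ (N ℕ.* v) k) (cong (_+ ι k) (ι-* N v)))) le)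

  1≤D : 1 ℕ.≤ D
  1≤D = nonzero D (toℕ-≤ Nm≤ND+k)
    where
    nonzero : ∀ D → N ℕ.* m ℕ.≤ N ℕ.* D ℕ.+ k → 1 ℕ.≤ D
    nonzero (suc D) _  = s≤s z≤n
    nonzero zero    le = contradiction (ℕ.≤-trans k<N (ℕ.≤-trans (ℕ.≤-reflexive (sym (ℕ.*-identityʳ N)))
      (ℕ.≤-trans (ℕ.*-monoʳ-≤ N 1≤m) (ℕ.≤-trans le (ℕ.≤-reflexive (cong (ℕ._+ k) (ℕ.*-zeroʳ N))))))) (ℕ.<-irrefl refl)

  D≤m+k : D ℕ.≤ m ℕ.+ k
  D≤m+k = ℕ.*-cancelˡ-≤ N (ℕ.≤-trans (toℕ-≤ ND≤Nm+k)
    (ℕ.≤-trans (ℕ.+-monoʳ-≤ (N ℕ.* m) (ℕ.m≤n*m k N)) (ℕ.≤-reflexive (sym (ℕ.*-distribˡ-+ N m k)))))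

  below : ∀ j → ι (p j) ≤ (ι D + α) * x j
  below j = ≤-via _ (0≤-*⁻ (0<ι {N} (s≤s z≤n)) (subst (0ℚ ≤_) eq nonneg)) refl
    where
    nonneg : 0ℚ ≤ (ι N * ι m * x j + 1ℚ - ι N * ι (p j)) + (ι N * ι D + ι k - ι N * ι m) * x j
                   + ((α * ι N - (ω + ι k)) * x j + ω * (x j - η))
    nonneg = 0≤-+ (0≤-+ (p≤q⇒0≤q-p (proj₁ (close j))) (0≤-* (p≤q⇒0≤q-p Nm≤ND+k) (0≤x j)))
      (0≤-+ (0≤-* (p≤q⇒0≤q-p N-large) (0≤x j)) (0≤-* 0≤ω (p≤q⇒0≤q-p (η≤x j))))
      where
      0≤ω : 0ℚ ≤ ω
      0≤ω = 0≤-*⁻ 0<η (subst (0ℚ ≤_) (trans (sym ωη≡1) (*-comm ω η)) 0≤1)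
    eq : (ι N * ι m * x j + 1ℚ - ι N * ι (p j)) + (ι N * ι D + ι k - ι N * ι m) * x j
                   + ((α * ι N - (ω + ι k)) * x j + ω * (x j - η)) ≡ ι N * ((ι D + α) * x j - ι (p j))
    eq = trans (cong (λ z → (ι N * ι m * x j + z - ι N * ι (p j)) + (ι N * ι D + ι k - ι N * ι m) * x j
                   + ((α * ι N - (ω + ι k)) * x j + ω * (x j - η))) (sym ωη≡1))
      (solve 9 (λ N m x p D k a o e → (N :* m :* x :+ o :* e :- N :* p) :+ (N :* D :+ k :- N :* m) :* x
                   :+ ((a :* N :- (o :+ k)) :* x :+ o :* (x :- e)) := N :* ((D :+ a) :* x :- p)) refl
        (ι N) (ι m) (x j) (ι (p j)) (ι D) (ι k) α ω η)

-- The threshold `η` is chosen after the bound `B` for `K` coordinates and `½ * α`, because the loss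
-- from a dropped coordinate grows with `D`. Only then can `N` be chosen for the case in which all
-- coordinates are at least `η`. The sum of the two bounds covers both cases.
approximate : ∀ K α → 0ℚ < α → ∃ λ B → ∀ (x : Vector ℚ K) → (∀ j → 0ℚ ≤ x j) → sum x ≡ 1ℚ → Approximation α B x
approximate zero    α 0<α = 0 , λ x _ Σx≡1 → contradiction (sym Σx≡1) 1≢0
approximate (suc K) α 0<α = B ℕ.+ C , approx
  where
  IH = approximate K (½ * α) (0<-* (positive⁻¹ ½) 0<α)
  B = proj₁ IH
  rβ = reciprocal {ι B + α} (subst (0ℚ <_) (+-comm α (ι B)) (0<-+ 0<α (0≤ι B)))
  β = proj₁ rβ
  η = ½ * α * β

  ηeq : η * (ι B + α) ≡ ½ * α
  ηeq = trans (*-assoc (½ * α) β (ι B + α)) (trans (cong (½ * α *_) (proj₂ (proj₂ rβ))) (*-identityʳ (½ * α)))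

  0<η : 0ℚ < η
  0<η = 0<-* (0<-* (positive⁻¹ ½) 0<α) (proj₁ (proj₂ rβ))

  ω = proj₁ (reciprocal 0<η)
  γ = proj₁ (reciprocal 0<α)
  γα≡1 : γ * α ≡ 1ℚ
  γα≡1 = proj₂ (proj₂ (reciprocal 0<α))
  M = proj₁ (archimedean (γ * (ω + ι (suc K))))
  -- `M` makes `α * ι N` large enough to absorb the errors; the other summand exceeds the number
  -- `suc K` of coordinates, which keeps `D` positive.
  N = M ℕ.+ suc (suc K)
  C = N ℕ.^ suc K ℕ.+ suc K

  N-large : ω + ι (suc K) ≤ α * ι N
  N-large = subst (_≤ α * ι N)
    (trans (solve 3 (λ a g z → a :* (g :* z) := (g :* a) :* z) refl α γ (ω + ι (suc K)))
      (trans (cong (_* (ω + ι (suc K))) γα≡1) (*-identityˡ _)))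
    (*-monoˡ-≤-nonNeg α {{nonNegative (<⇒≤ 0<α)}}
      (≤-trans (proj₂ (archimedean (γ * (ω + ι (suc K))))) (ι-mono (ℕ.m≤m+n M (suc (suc K))))))

  approx : ∀ (x : Vector ℚ (suc K)) → (∀ j → 0ℚ ≤ x j) → sum x ≡ 1ℚ → Approximation α (B ℕ.+ C) x
  approx x 0≤x Σx≡1 = cases (any? (λ j → x j <? η))
    where
    cases : Dec (∃ λ j → x j < η) → Approximation α (B ℕ.+ C) x
    cases (yes (j , xj<η)) = drop-coordinate α η B (B ℕ.+ C) 0<α (ℕ.m≤m+n B C) ηeq (proj₂ IH) x 0≤x Σx≡1 j xj<η
    cases (no none)        = large-coordinates α η ω N (B ℕ.+ C) 0<η (proj₂ (proj₂ (reciprocal 0<η))) N-large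
      (ℕ.m≤n+m (suc (suc K)) M) (ℕ.m≤n+m C B) x (λ j → ≮⇒≥ (λ xj<η → none (j , xj<η))) Σx≡1

-- Convex hulls and vertices

⟨,⟩-comm : ∀ {d} (u x : Point d) → ⟨ u , x ⟩ ≡ ⟨ x , u ⟩
⟨,⟩-comm u x = sum-cong-≗ (λ j → *-comm (u j) (x j))

⟨,⟩-congʳ : ∀ {d} (u : Point d) {x y : Point d} → x ≗ y → ⟨ u , x ⟩ ≡ ⟨ u , y ⟩
⟨,⟩-congʳ u x≗y = sum-cong-≗ (λ j → cong (u j *_) (x≗y j))

⟨,⟩-congˡ : ∀ {d} {u w : Point d} (x : Point d) → u ≗ w → ⟨ u , x ⟩ ≡ ⟨ w , x ⟩
⟨,⟩-congˡ x u≗w = sum-cong-≗ (λ j → cong (_* x j) (u≗w j))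

⟨,⟩-combinationʳ : ∀ {d k} (u : Point d) (μ : Vector ℚ k) (v : Vector (Point d) k) →
  ⟨ u , combination μ v ⟩ ≡ sum (λ i → μ i * ⟨ u , v i ⟩)
⟨,⟩-combinationʳ u μ v = begin
  sum (λ j → u j * sum (λ i → μ i * v i j))
    ≡⟨ sum-cong-≗ (λ j → sym (sum-*ˡ (u j) (λ i → μ i * v i j))) ⟩
  sum (λ j → sum (λ i → u j * (μ i * v i j)))
    ≡⟨ ∑-comm (λ j i → u j * (μ i * v i j)) ⟩
  sum (λ i → sum (λ j → u j * (μ i * v i j)))
    ≡⟨ sum-cong-≗ (λ i → trans
         (sum-cong-≗ (λ j → solve 3 (λ u m v → u :* (m :* v) := m :* (u :* v)) refl (u j) (μ i) (v i j)))
         (sum-*ˡ (μ i) (λ j → u j * v i j))) ⟩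
  sum (λ i → μ i * ⟨ u , v i ⟩) ∎
  where open ≡-Reasoning

⟨,⟩-combinationˡ : ∀ {d k} (μ : Vector ℚ k) (v : Vector (Point d) k) (x : Point d) →
  ⟨ combination μ v , x ⟩ ≡ sum (λ i → μ i * ⟨ v i , x ⟩)
⟨,⟩-combinationˡ μ v x = trans (⟨,⟩-comm (combination μ v) x) (trans (⟨,⟩-combinationʳ x μ v)
  (sum-cong-≗ (λ i → cong (μ i *_) (⟨,⟩-comm x (v i)))))

⟨,⟩-negˡ : ∀ {d} (u x : Point d) → ⟨ (λ j → - u j) , x ⟩ ≡ - ⟨ u , x ⟩
⟨,⟩-negˡ u x = trans (sum-cong-≗ (λ j → solve 2 (λ u x → (:- u) :* x := :- (u :* x)) refl (u j) (x j)))
  (sum-neg (λ j → u j * x j))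

⟨,⟩-segment : ∀ {d} (u x y : Point d) t →
  ⟨ u , (λ j → (1ℚ - t) * x j + t * y j) ⟩ ≡ (1ℚ - t) * ⟨ u , x ⟩ + t * ⟨ u , y ⟩
⟨,⟩-segment u x y t = trans
  (sum-cong-≗ (λ j → solve 4 (λ u x y t → u :* ((con 1ℚ :- t) :* x :+ t :* y) := (con 1ℚ :- t) :* (u :* x) :+ t :* (u :* y)) refl
    (u j) (x j) (y j) t))
  (trans (∑-distrib-+ (λ j → (1ℚ - t) * (u j * x j)) (λ j → t * (u j * y j)))
    (cong₂ _+_ (sum-*ˡ (1ℚ - t) (λ j → u j * x j)) (sum-*ˡ t (λ j → u j * y j))))

δ : ∀ {n} → Fin n → Fin n → ℚ
δ zero    zero    = 1ℚ
δ zero    (suc j) = 0ℚ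
δ (suc i) zero    = 0ℚ
δ (suc i) (suc j) = δ i j

0≤δ : ∀ {n} (i j : Fin n) → 0ℚ ≤ δ i j
0≤δ zero    zero    = 0≤1
0≤δ zero    (suc j) = ≤-refl
0≤δ (suc i) zero    = ≤-refl
0≤δ (suc i) (suc j) = 0≤δ i j

δ-sym : ∀ {n} (i j : Fin n) → δ i j ≡ δ j i
δ-sym zero    zero    = refl
δ-sym zero    (suc j) = refl
δ-sym (suc i) zero    = refl
δ-sym (suc i) (suc j) = δ-sym i j

sum-δ : ∀ {n} (i : Fin n) (f : Vector ℚ n) → sum (λ j → δ i j * f j) ≡ f i
sum-δ zero    f = trans (cong₂ _+_ (*-identityˡ (f zero)) (sum-zero (λ j → 0ℚ * f (suc j)) (λ j → *-zeroˡ (f (suc j)))))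
  (+-identityʳ (f zero))
sum-δ (suc i) f = trans (cong₂ _+_ (*-zeroˡ (f zero)) (sum-δ i (λ j → f (suc j)))) (+-identityˡ (f (suc i)))

weighted-sum-≤ : ∀ {k} (μ : Vector ℚ k) → (∀ i → 0ℚ ≤ μ i) → (f g : Vector ℚ k) → (∀ i → f i ≤ g i) →
  sum (λ i → μ i * f i) ≤ sum (λ i → μ i * g i)
weighted-sum-≤ μ 0≤μ f g f≤g = sum-mono (λ i → μ i * f i) (λ i → μ i * g i)
  (λ i → *-monoˡ-≤-nonNeg (μ i) {{nonNegative (0≤μ i)}} (f≤g i))

average-const : ∀ {k} (μ : Vector ℚ k) → sum μ ≡ 1ℚ → ∀ r → sum (λ i → μ i * r) ≡ r
average-const μ Σμ≡1 r = trans (sum-*ʳ r μ) (trans (cong (_* r) Σμ≡1) (*-identityˡ r))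

average-tight : ∀ {k} (μ : Vector ℚ k) → (∀ i → 0ℚ ≤ μ i) → sum μ ≡ 1ℚ → (f : Vector ℚ k) → ∀ M →
  (∀ i → μ i ≡ 0ℚ ⊎ f i ≤ M) → sum (λ i → μ i * f i) ≡ M → ∀ i → μ i ≡ 0ℚ ⊎ f i ≡ M
average-tight μ 0≤μ Σμ≡1 f M f≤M Σ≡M i with μ i ≟ 0ℚ
... | yes μi≡0 = inj₁ μi≡0
... | no μi≢0  = inj₂ (sym (q-p≡0⇒q≡p (pq≡0⇒q≡0 0<μi
    (sum≡0⇒≡0 (λ i → μ i * (M - f i)) nonneg total i))))
  where
  0<μi : 0ℚ < μ i
  0<μi = ≰⇒> (λ μi≤0 → μi≢0 (≤-antisym μi≤0 (0≤μ i)))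
  nonneg : ∀ i → 0ℚ ≤ μ i * (M - f i)
  nonneg i = [ (λ μi≡0 → ≤-reflexive (sym (trans (cong (_* (M - f i)) μi≡0) (*-zeroˡ (M - f i)))))
             , (λ fi≤M → 0≤-* (0≤μ i) (p≤q⇒0≤q-p fi≤M)) ]′ (f≤M i)
  total : sum (λ i → μ i * (M - f i)) ≡ 0ℚ
  total = trans (sum-cong-≗ (λ i → solve 3 (λ m M f → m :* (M :- f) := m :* M :- m :* f) refl (μ i) M (f i)))
    (trans (sum-sub (λ i → μ i * M) (λ i → μ i * f i))
      (trans (cong₂ _-_ (average-const μ Σμ≡1 M) Σ≡M) (+-inverseʳ M)))

average-≤ : ∀ {k} (μ : Vector ℚ k) → (∀ i → 0ℚ ≤ μ i) → sum μ ≡ 1ℚ → (f : Vector ℚ k) → ∀ M →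
  (∀ i → μ i ≡ 0ℚ ⊎ f i ≤ M) → sum (λ i → μ i * f i) ≤ M
average-≤ μ 0≤μ Σμ≡1 f M f≤M = subst (sum (λ i → μ i * f i) ≤_) (average-const μ Σμ≡1 M)
  (sum-mono (λ i → μ i * f i) (λ i → μ i * M) term)
  where
  term : ∀ i → μ i * f i ≤ μ i * M
  term i = [ (λ μi≡0 → ≤-reflexive (trans (trans (cong (_* f i) μi≡0) (*-zeroˡ (f i))) (sym (trans (cong (_* M) μi≡0) (*-zeroˡ M)))))
           , (λ fi≤M → *-monoˡ-≤-nonNeg (μ i) {{nonNegative (0≤μ i)}} fi≤M) ]′ (f≤M i)

generator∈hull : ∀ {d k} (v : Vector (Point d) k) j → ConvexHull v (v j)
generator∈hull v j = δ j , 0≤δ j , trans (sum-cong-≗ (λ i → sym (*-identityʳ (δ j i)))) (sum-δ j (λ _ → 1ℚ)) ,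
  λ l → sum-δ j (λ i → v i l)

hull-≤ : ∀ {d k} (v : Vector (Point d) k) (u : Point d) M → (∀ j → ⟨ u , v j ⟩ ≤ M) →
  ∀ x → ConvexHull v x → ⟨ u , x ⟩ ≤ M
hull-≤ v u M v≤M x (μ , 0≤μ , Σμ≡1 , x≗) = subst (_≤ M)
  (trans (sym (⟨,⟩-combinationʳ u μ v)) (⟨,⟩-congʳ u x≗))
  (average-≤ μ 0≤μ Σμ≡1 (λ j → ⟨ u , v j ⟩) M (λ j → inj₂ (v≤M j)))

maximum : ∀ {A : Set} (_≼_ : A → A → Set) → (∀ x y → x ≼ y ⊎ y ≼ x) → (∀ {x y z} → x ≼ y → y ≼ z → x ≼ z) →
  ∀ {k} (f : Fin (suc k) → A) → ∃ λ m → ∀ j → f j ≼ f m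
maximum _≼_ total ≼-trans {zero}  f = zero , λ { zero → [ (λ r → r) , (λ r → r) ]′ (total (f zero) (f zero)) }
maximum _≼_ total ≼-trans {suc k} f with maximum _≼_ total ≼-trans (λ j → f (suc j))
... | m , f≼fm with total (f zero) (f (suc m))
... | inj₁ f0≼fm = suc m , λ { zero → f0≼fm ; (suc j) → f≼fm j }
... | inj₂ fm≼f0 = zero , λ { zero → [ (λ r → r) , (λ r → r) ]′ (total (f zero) (f zero)) ; (suc j) → ≼-trans (f≼fm j) fm≼f0 }

-- Lexicographic order

infix 4 _≼_

_≼_ : ∀ {r} → Vector ℚ r → Vector ℚ r → Set
_≼_ {zero}  x y = ⊤
_≼_ {suc r} x y = head x < head y ⊎ (head x ≡ head y × tail x ≼ tail y)

≼-total : ∀ {r} (x y : Vector ℚ r) → x ≼ y ⊎ y ≼ x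
≼-total {zero}  x y = inj₁ tt
≼-total {suc r} x y with <-cmp (head x) (head y)
... | tri< x<y _ _ = inj₁ (inj₁ x<y)
... | tri> _ _ y<x = inj₂ (inj₁ y<x)
... | tri≈ _ x≡y _ with ≼-total (tail x) (tail y)
... | inj₁ le = inj₁ (inj₂ (x≡y , le))
... | inj₂ le = inj₂ (inj₂ (sym x≡y , le))

≼-trans : ∀ {r} {x y z : Vector ℚ r} → x ≼ y → y ≼ z → x ≼ z
≼-trans {zero}  _ _ = tt
≼-trans {suc r} (inj₁ x<y) (inj₁ y<z) = inj₁ (<-trans x<y y<z)
≼-trans {suc r} (inj₁ x<y) (inj₂ (y≡z , _)) = inj₁ (subst (_ <_) y≡z x<y)
≼-trans {suc r} (inj₂ (x≡y , _)) (inj₁ y<z) = inj₁ (subst (_< _) (sym x≡y) y<z)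
≼-trans {suc r} (inj₂ (x≡y , p)) (inj₂ (y≡z , q)) = inj₂ (trans x≡y y≡z , ≼-trans p q)

≼-head : ∀ {r} (x y : Vector ℚ (suc r)) → x ≼ y → head x ≤ head y
≼-head x y (inj₁ x<y)       = <⇒≤ x<y
≼-head x y (inj₂ (x≡y , _)) = ≤-reflexive x≡y

≼-tail : ∀ {r} (x y : Vector ℚ (suc r)) → x ≼ y → head x ≡ head y → tail x ≼ tail y
≼-tail x y (inj₁ x<y)     x≡y = contradiction x<y (<-irrefl x≡y)
≼-tail x y (inj₂ (_ , p)) _   = p

-- If the average of the heads reaches `head y`, every point of nonzero weight has that head and the
-- comparison passes to the tails. Nothing is known about the tails of the other points, hence the
-- alternative `μ i ≡ 0ℚ`.
≼-average : ∀ {k} (μ : Vector ℚ k) → (∀ i → 0ℚ ≤ μ i) → sum μ ≡ 1ℚ → ∀ {r} (X : Fin k → Vector ℚ r) (x y : Vector ℚ r) →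
  (∀ l → sum (λ i → μ i * X i l) ≡ x l) → (∀ i → μ i ≡ 0ℚ ⊎ X i ≼ y) → x ≼ y
≼-average μ 0≤μ Σμ≡1 {zero}  X x y x≡ X≼y = tt
≼-average {k} μ 0≤μ Σμ≡1 {suc r} X x y x≡ X≼y = compare (head x <? head y)
  where
  heads : ∀ i → μ i ≡ 0ℚ ⊎ head (X i) ≤ head y
  heads i = [ inj₁ , (λ p → inj₂ (≼-head (X i) y p)) ]′ (X≼y i)

  x≤y : head x ≤ head y
  x≤y = subst (_≤ head y) (x≡ zero) (average-≤ μ 0≤μ Σμ≡1 (λ i → head (X i)) (head y) heads)

  tails : head x ≡ head y → ∀ i → μ i ≡ 0ℚ ⊎ tail (X i) ≼ tail y
  tails x≡y i with X≼y i | average-tight μ 0≤μ Σμ≡1 (λ i → head (X i)) (head y) heads (trans (x≡ zero) x≡y) i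
  ... | inj₁ μi≡0 | _ = inj₁ μi≡0
  ... | inj₂ _ | inj₁ μi≡0 = inj₁ μi≡0
  ... | inj₂ p | inj₂ eq = inj₂ (≼-tail (X i) y p eq)

  compare : Dec (head x < head y) → x ≼ y
  compare (yes x<y) = inj₁ x<y
  compare (no x≮y)  = inj₂ (x≡y , ≼-average μ 0≤μ Σμ≡1 (λ i → tail (X i)) (tail x) (tail y) (λ l → x≡ (suc l)) (tails x≡y))
    where
    x≡y : head x ≡ head y
    x≡y = ≤-antisym x≤y (≮⇒≥ x≮y)

-- The two head differences are nonnegative and have a vanishing combination with positive weights,
-- so both are zero; then the tails are comparable again.
≼-extreme : ∀ {r} (x y z : Vector ℚ r) t → 0ℚ < t → t < 1ℚ → (∀ l → x l ≡ (1ℚ - t) * y l + t * z l) →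
  y ≼ x → z ≼ x → ∀ l → y l ≡ x l × z l ≡ x l
≼-extreme {suc r} x y z t 0<t t<1 x≡ y≼x z≼x = pointwise
  where
  0<1-t : 0ℚ < 1ℚ - t
  0<1-t = p<q⇒0<q-p t<1
  0≤x-y : 0ℚ ≤ head x - head y
  0≤x-y = p≤q⇒0≤q-p (≼-head y x y≼x)
  0≤x-z : 0ℚ ≤ head x - head z
  0≤x-z = p≤q⇒0≤q-p (≼-head z x z≼x)
  total : (1ℚ - t) * (head x - head y) + t * (head x - head z) ≡ 0ℚ
  total = trans (solve 4 (λ x y z t → (con 1ℚ :- t) :* (x :- y) :+ t :* (x :- z) := x :- ((con 1ℚ :- t) :* y :+ t :* z)) refl
      (head x) (head y) (head z) t)
    (trans (cong (λ w → head x - w) (sym (x≡ zero))) (+-inverseʳ (head x)))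
  y≡x : head y ≡ head x
  y≡x = sym (q-p≡0⇒q≡p (pq≡0⇒q≡0 0<1-t (+-≡0ˡ (0≤-* (<⇒≤ 0<1-t) 0≤x-y) (0≤-* (<⇒≤ 0<t) 0≤x-z) total)))
  z≡x : head z ≡ head x
  z≡x = sym (q-p≡0⇒q≡p (pq≡0⇒q≡0 0<t (+-≡0ˡ (0≤-* (<⇒≤ 0<t) 0≤x-z) (0≤-* (<⇒≤ 0<1-t) 0≤x-y)
    (trans (+-comm (t * (head x - head z)) ((1ℚ - t) * (head x - head y))) total))))
  pointwise : ∀ l → y l ≡ x l × z l ≡ x l
  pointwise zero    = y≡x , z≡x
  pointwise (suc l) = ≼-extreme (tail x) (tail y) (tail z) t 0<t t<1 (λ l → x≡ (suc l))
    (≼-tail y x y≼x y≡x) (≼-tail z x z≼x z≡x) l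

-- The lexicographically largest point for (⟨ u , x ⟩ , x) is extreme.
maximal-vertex : ∀ {d k} (S : Pred (Point d) 0ℓ) (v : Vector (Point d) (suc k)) → (∀ x → S x ⇔ ConvexHull v x) →
  ∀ u → ∃ λ w → IsVertex S w × (∀ x → S x → ⟨ u , x ⟩ ≤ ⟨ u , w ⟩)
maximal-vertex {d} S v S⇔hull u = w , (Equivalence.from (S⇔hull w) (generator∈hull v m) , extreme) ,
  λ x x∈S → ≼-head (φ x) (φ w) (φ≼ x x∈S)
  where
  φ : Point d → Vector ℚ (suc d)
  φ x = ⟨ u , x ⟩ Vector.∷ x

  largest = maximum _≼_ ≼-total (λ {x} {y} {z} → ≼-trans {x = x} {y} {z}) (λ j → φ (v j))
  m = proj₁ largest
  w = v m

  φ≼ : ∀ x → S x → φ x ≼ φ w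
  φ≼ x x∈S with μ , 0≤μ , Σμ≡1 , x≗ ← Equivalence.to (S⇔hull x) x∈S =
    ≼-average μ 0≤μ Σμ≡1 (λ j → φ (v j)) (φ x) (φ w)
      (λ { zero → trans (sym (⟨,⟩-combinationʳ u μ v)) (⟨,⟩-congʳ u x≗) ; (suc l) → x≗ l })
      (λ j → inj₂ (proj₂ largest j))

  extreme : ∀ (y z : Point d) t → S y → S z → 0ℚ < t → t < 1ℚ → (∀ j → w j ≡ (1ℚ - t) * y j + t * z j) → y ≗ w × z ≗ w
  extreme y z t y∈S z∈S 0<t t<1 w≡ = (λ l → proj₁ (equal (suc l))) , (λ l → proj₂ (equal (suc l)))
    where
    equal = ≼-extreme (φ w) (φ y) (φ z) t 0<t t<1
      (λ { zero → trans (⟨,⟩-congʳ u w≡) (⟨,⟩-segment u y z t) ; (suc l) → w≡ l }) (φ≼ y y∈S) (φ≼ z z∈S)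

-- Lattice polytopes

Integral : ℚ → Set
Integral q = ∃ λ (z : ℤ) → z / 1 ≡ q

integral-* : ∀ {p q} → Integral p → Integral q → Integral (p * q)
integral-* (y , refl) (z , refl) = y ℤ.* z , /1-* y z

integral-sum : ∀ {n} (f : Vector ℚ n) → (∀ i → Integral (f i)) → Integral (sum f)
integral-sum {zero}  f _ = 0ℤ , refl
integral-sum {suc n} f int = y ℤ.+ z , trans (/1-+ y z) (cong₂ _+_ eqy eqz)
  where
  y   = proj₁ (int zero)
  eqy = proj₂ (int zero)
  z   = proj₁ (integral-sum (λ i → f (suc i)) (λ i → int (suc i)))
  eqz = proj₂ (integral-sum (λ i → f (suc i)) (λ i → int (suc i)))

decidable-subset : ∀ {n} {P : Fin n → Set} → (∀ i → Dec (P i)) → Σ (Subset n) λ I → ∀ i → i ∈ I ⇔ P i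
decidable-subset {n} {P} P? = I , λ i → mk⇔ (to i) (from i)
  where
  I : Subset n
  I = Vec.tabulate (λ i → does (P? i))
  lookup-I : ∀ i → Vec.lookup I i ≡ does (P? i)
  lookup-I i = Vec.lookup∘tabulate (λ i → does (P? i)) i
  to : ∀ i → i ∈ I → P i
  to i i∈I with P? i | trans (sym (lookup-I i)) (Vec.[]=⇒lookup i∈I)
  ... | yes Pi | _ = Pi
  from : ∀ i → P i → i ∈ I
  from i Pi = Vec.lookup⇒[]= i I (trans (lookup-I i) (dec-true (P? i) Pi))

-- `value l (δ i)` is the total weight of all occurrences of `i` in `l`; this turns a list into a
-- coefficient vector.
value-δ : ∀ {n} (l : Certificate (Fin n)) (f : Fin n → ℚ) → value l f ≡ sum (λ i → value l (δ i) * f i)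
value-δ l f = trans
  (value-cong l (λ x → sym (trans (sum-cong-≗ (λ i → cong (_* f i) (δ-sym i x))) (sum-δ x f))))
  (value-⟨,⟩ l (λ x i → δ i x) f)

value-δ-nonneg : ∀ {n} (l : Certificate (Fin n)) → NonNegativeWeights l → ∀ i → 0ℚ ≤ value l (δ i)
value-δ-nonneg l 0≤l i = sum-nonneg (λ j → weight l j * δ i (index l j)) (λ j → 0≤-* (0≤l j) (0≤δ i (index l j)))

-- Strong duality for maximising `u`. The row `- u` with bound `- M - t` is added to the system, and
-- optimality of `M` means that no `t > 0` is feasible. A tight certificate gives this row positive
-- total weight, and dividing by that weight solves for `u`.
dual-solution : ∀ {n d} (a : Vector (Point d) n) (b : Vector ℚ n) (u x₀ : Point d) M →
  (∀ i → ⟨ a i , x₀ ⟩ ≤ b i) → ⟨ u , x₀ ⟩ ≡ M → (∀ x → (∀ i → ⟨ a i , x ⟩ ≤ b i) → ⟨ u , x ⟩ ≤ M) →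
  ∃ λ (μ : Vector ℚ n) → (∀ i → 0ℚ ≤ μ i) × combination μ a ≗ u × sum (λ i → μ i * b i) ≡ M
dual-solution {n} {d} a b u x₀ M feasible attained optimal = from-certificate
  (lp-duality rows bounds (δ zero) 0ℚ x₀ feasible′ infeasible)
  where
  rows : Vector (Point d) (suc n)
  rows = (λ k → - u k) Vector.∷ a

  bounds : Vector ℚ (suc n)
  bounds = (- M) Vector.∷ b

  feasible′ : ∀ i → ⟨ rows i , x₀ ⟩ ≤ bounds i - 0ℚ * δ zero i
  feasible′ zero    = ≤-reflexive (trans (⟨,⟩-negˡ u x₀) (trans (cong -_ attained)
    (solve 1 (λ M → :- M := :- M :- con 0ℚ :* con 1ℚ) refl M)))
  feasible′ (suc i) = subst (⟨ a i , x₀ ⟩ ≤_) (solve 1 (λ b → b := b :- con 0ℚ :* con 0ℚ) refl (b i)) (feasible i)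

  infeasible : ∀ t x → (∀ i → ⟨ rows i , x ⟩ ≤ bounds i - t * δ zero i) → t ≤ 0ℚ
  infeasible t x ok = ≤-via ((- M - t * 1ℚ - ⟨ rows zero , x ⟩) + (M - ⟨ u , x ⟩))
    (0≤-+ (p≤q⇒0≤q-p (ok zero)) (p≤q⇒0≤q-p (optimal x
      (λ i → subst (⟨ a i , x ⟩ ≤_) (solve 2 (λ b t → b :- t :* con 0ℚ := b) refl (b i) t) (ok (suc i))))))
    (sym (trans (cong (λ z → (- M - t * 1ℚ - z) + (M - ⟨ u , x ⟩)) (⟨,⟩-negˡ u x))
      (solve 3 (λ M t z → (:- M :- t :* con 1ℚ :- (:- z)) :+ (M :- z) := con 0ℚ :- t) refl M t ⟨ u , x ⟩)))

  from-certificate : (∃ λ l → IsCertificate rows l × 0ℚ < value l (δ zero) × value l bounds ≡ 0ℚ * value l (δ zero)) → _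
  from-certificate (l , (_ , 0≤l , ann) , 0<W , tight) = μ ,
    (λ i → 0≤-* (<⇒≤ 0<r) (value-δ-nonneg l 0≤l (suc i))) ,
    (λ k → dual (λ i → rows i k) (u k) refl (ann k)) ,
    dual bounds M refl (trans tight (*-zeroˡ (value l (δ zero))))
    where
    W = value l (δ zero)
    r = proj₁ (reciprocal 0<W)
    0<r = proj₁ (proj₂ (reciprocal 0<W))
    rW≡1 : r * W ≡ 1ℚ
    rW≡1 = proj₂ (proj₂ (reciprocal 0<W))

    μ : Vector ℚ n
    μ i = r * value l (δ (suc i))

    dual : ∀ (f : Vector ℚ (suc n)) q → f zero ≡ - q → value l f ≡ 0ℚ → sum (λ i → μ i * f (suc i)) ≡ q
    dual f q f0≡ vanishes = begin
      sum (λ i → r * value l (δ (suc i)) * f (suc i))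
        ≡⟨ sum-cong-≗ (λ i → *-assoc r (value l (δ (suc i))) (f (suc i))) ⟩
      sum (λ i → r * (value l (δ (suc i)) * f (suc i)))
        ≡⟨ sum-*ˡ r (λ i → value l (δ (suc i)) * f (suc i)) ⟩
      r * Σ′
        ≡⟨ solve 4 (λ r W q S → r :* S := (r :* W) :* q :+ r :* (W :* (:- q) :+ S)) refl r W q Σ′ ⟩
      (r * W) * q + r * (W * - q + Σ′)
        ≡⟨ cong₂ (λ s t → s * q + r * t) rW≡1 (trans (cong (λ z → W * z + Σ′) (sym f0≡)) (trans (sym (value-δ l f)) vanishes)) ⟩
      1ℚ * q + r * 0ℚ
        ≡⟨ solve 2 (λ q r → con 1ℚ :* q :+ r :* con 0ℚ := q) refl q r ⟩
      q ∎
      where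
      open ≡-Reasoning
      Σ′ = sum (λ i → value l (δ (suc i)) * f (suc i))

module _ {d : ℕ} (P : LatticePolytope d) where
  open LatticePolytope P

  nonempty : ∃ carrier
  nonempty = point (fullDimensional (λ _ → 0ℚ))
    where
    point : AffineHull carrier (λ _ → 0ℚ) → ∃ carrier
    point (zero  , v , μ , _ , Σμ≡1 , _) = contradiction (sym Σμ≡1) 1≢0
    point (suc k , v , μ , v∈ , _)       = v zero , v∈ zero

  generators : ∃ λ k → Σ (Vector (Point d) (suc k)) λ v → ∀ x → carrier x ⇔ ConvexHull v x
  generators = nonzero polytope
    where
    nonzero : IsPolytope carrier → _
    nonzero (suc k , v , P⇔hull) = k , v , P⇔hull
    nonzero (zero  , v , P⇔hull) = contradiction (sym (proj₁ (proj₂ (proj₂ (Equivalence.to (P⇔hull (proj₁ nonempty)) (proj₂ nonempty)))))) 1≢0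

  -- The point witnessing irredundancy violates inequality `i` only. The segment to it from a point
  -- of P crosses the hyperplane of `i`, and the crossing point satisfies the other inequalities by
  -- convexity.
  facet-nonempty : ∀ i → ∃ λ x → carrier x × ⟨ toℚ (a i) , x ⟩ ≡ b i
  facet-nonempty i = z , z∈P , z-tight
    where
    p = proj₁ nonempty
    x = proj₁ (irredundant i)
    A B : Fin n → ℚ
    A j = ⟨ toℚ (a j) , p ⟩
    B j = ⟨ toℚ (a j) , x ⟩

    A≤b : ∀ j → A j ≤ b j
    A≤b = proj₂ nonempty
    b<B : b i < B i
    b<B = ≰⇒> (proj₂ (proj₂ (irredundant i)))

    0<B-A : 0ℚ < B i - A i
    0<B-A = p<q⇒0<q-p (≤-<-trans (A≤b i) b<B)
    r = proj₁ (reciprocal 0<B-A)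
    0<r = proj₁ (proj₂ (reciprocal 0<B-A))
    r-inv : r * (B i - A i) ≡ 1ℚ
    r-inv = proj₂ (proj₂ (reciprocal 0<B-A))

    t = r * (b i - A i)
    0≤t : 0ℚ ≤ t
    0≤t = 0≤-* (<⇒≤ 0<r) (p≤q⇒0≤q-p (A≤b i))
    0≤1-t : 0ℚ ≤ 1ℚ - t
    0≤1-t = subst (0ℚ ≤_)
      (trans (solve 4 (λ r A b B → r :* (B :- b) := r :* (B :- A) :- r :* (b :- A)) refl r (A i) (b i) (B i)) (cong (_- t) r-inv))
      (0≤-* (<⇒≤ 0<r) (p≤q⇒0≤q-p (<⇒≤ b<B)))

    z : Point d
    z j = (1ℚ - t) * p j + t * x j

    z-tight : ⟨ toℚ (a i) , z ⟩ ≡ b i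
    z-tight = trans (⟨,⟩-segment (toℚ (a i)) p x t)
      (trans (solve 4 (λ r A b B → (con 1ℚ :- r :* (b :- A)) :* A :+ r :* (b :- A) :* B := A :+ r :* (B :- A) :* (b :- A)) refl r (A i) (b i) (B i))
      (trans (cong (λ s → A i + s * (b i - A i)) r-inv) (solve 2 (λ A b → A :+ con 1ℚ :* (b :- A) := b) refl (A i) (b i))))

    z∈P : carrier z
    z∈P j = cases (j Fin.≟ i)
      where
      cases : Dec (j ≡ i) → ⟨ toℚ (a j) , z ⟩ ≤ b j
      cases (yes refl) = ≤-reflexive z-tight
      cases (no j≢i)   = subst (_≤ b j) (sym (⟨,⟩-segment (toℚ (a j)) p x t))
        (≤-via ((1ℚ - t) * (b j - A j) + t * (b j - B j))
          (0≤-+ (0≤-* 0≤1-t (p≤q⇒0≤q-p (A≤b j))) (0≤-* 0≤t (p≤q⇒0≤q-p (proj₁ (proj₂ (irredundant i)) j j≢i))))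
          (solve 4 (λ t A b B → b :- ((con 1ℚ :- t) :* A :+ t :* B) := (con 1ℚ :- t) :* (b :- A) :+ t :* (b :- B)) refl t (A j) (b j) (B j)))

  b-integral : ∀ i → Integral (b i)
  b-integral i = subst Integral value≡b
      (integral-sum (λ j → toℚ (a i) j * toℚ z j) (λ j → integral-* (a i j , refl) (z j , refl)))
    where
    v       = proj₁ (proj₂ generators)
    top     = maximal-vertex carrier v (proj₂ (proj₂ generators)) (toℚ (a i))
    w       = proj₁ top
    lattice = vertices w (proj₁ (proj₂ top))
    z       = proj₁ lattice
    value≡b : ⟨ toℚ (a i) , toℚ z ⟩ ≡ b i
    value≡b = trans (⟨,⟩-congʳ (toℚ (a i)) (λ j → sym (proj₂ lattice j))) (≤-antisym
      (proj₁ (proj₁ (proj₂ top)) i)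
      (subst (_≤ ⟨ toℚ (a i) , w ⟩) (proj₂ (proj₂ (facet-nonempty i))) (proj₂ (proj₂ top) _ (proj₁ (proj₂ (facet-nonempty i))))))

  -- The fan is complete.
  normal-cone : ∀ (y : Lattice d) → Σ (Subset n) λ I → NormalFan P I × InCone a I y ×
    (∃ λ x → carrier x × (∀ i → i ∈ I → ⟨ toℚ (a i) , x ⟩ ≡ b i))
  normal-cone y = I , (u , I⇔) , (μ , 0≤μ , supported , Σμa) , x₀ , x₀∈P , λ i i∈I → Equivalence.to (I⇔ i) i∈I x₀ x₀∈Face
    where
    u = toℚ y
    v      = proj₁ (proj₂ generators)
    P⇔hull = proj₂ (proj₂ generators)
    top = maximum _≤_ ≤-total ≤-trans (λ j → ⟨ u , v j ⟩)
    x₀ = v (proj₁ top)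
    M = ⟨ u , x₀ ⟩

    v∈P : ∀ j → carrier (v j)
    v∈P j = Equivalence.from (P⇔hull (v j)) (generator∈hull v j)

    x₀∈P : carrier x₀
    x₀∈P = v∈P (proj₁ top)

    u≤M : ∀ x → carrier x → ⟨ u , x ⟩ ≤ M
    u≤M x x∈P = hull-≤ v u M (proj₂ top) x (Equivalence.to (P⇔hull x) x∈P)

    x₀∈Face : Face carrier u x₀
    x₀∈Face = x₀∈P , u≤M

    -- A face is the hull of the generators lying on it, so testing these finitely many points makes
    -- the condition decidable and `I` can be formed.
    ContainsFace : Fin n → Set
    ContainsFace i = ∀ j → ⟨ u , v j ⟩ ≡ M → ⟨ toℚ (a i) , v j ⟩ ≡ b i

    face⇒generators : ∀ i → (∀ x → Face carrier u x → ⟨ toℚ (a i) , x ⟩ ≡ b i) → ContainsFace i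
    face⇒generators i tight j uv≡M = tight (v j) (v∈P j , λ x x∈P → subst (⟨ u , x ⟩ ≤_) (sym uv≡M) (u≤M x x∈P))

    generators⇒face : ∀ i → ContainsFace i → ∀ x → Face carrier u x → ⟨ toℚ (a i) , x ⟩ ≡ b i
    generators⇒face i tight x (x∈P , u≤ux) = from-hull (Equivalence.to (P⇔hull x) x∈P)
      where
      from-hull : ConvexHull v x → ⟨ toℚ (a i) , x ⟩ ≡ b i
      from-hull (μ , 0≤μ , Σμ≡1 , x≗) = trans (⟨,⟩-congʳ (toℚ (a i)) (λ l → sym (x≗ l)))
        (trans (⟨,⟩-combinationʳ (toℚ (a i)) μ v) (trans (sum-cong-≗ term) (average-const μ Σμ≡1 (b i))))
        where
        on-face : ∀ j → μ j ≡ 0ℚ ⊎ ⟨ u , v j ⟩ ≡ M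
        on-face = average-tight μ 0≤μ Σμ≡1 (λ j → ⟨ u , v j ⟩) M (λ j → inj₂ (proj₂ top j))
          (trans (sym (⟨,⟩-combinationʳ u μ v)) (trans (⟨,⟩-congʳ u x≗) (≤-antisym (u≤M x x∈P) (u≤ux x₀ x₀∈P))))
        term : ∀ j → μ j * ⟨ toℚ (a i) , v j ⟩ ≡ μ j * b i
        term j = [ (λ μj≡0 → trans (cong (_* ⟨ toℚ (a i) , v j ⟩) μj≡0)
                     (trans (*-zeroˡ ⟨ toℚ (a i) , v j ⟩) (sym (trans (cong (_* b i) μj≡0) (*-zeroˡ (b i))))))
                 , (λ uv≡M → cong (μ j *_) (tight j uv≡M)) ]′ (on-face j)

    subset = decidable-subset {P = ContainsFace} (λ i → all? (λ j → (⟨ u , v j ⟩ ≟ M) →-dec (⟨ toℚ (a i) , v j ⟩ ≟ b i)))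
    I = proj₁ subset

    I⇔ : ∀ i → i ∈ I ⇔ (∀ x → Face carrier u x → ⟨ toℚ (a i) , x ⟩ ≡ b i)
    I⇔ i = mk⇔ (λ i∈I → generators⇒face i (Equivalence.to (proj₂ subset i) i∈I))
      (λ tight → Equivalence.from (proj₂ subset i) (face⇒generators i tight))

    dual = dual-solution (λ i → toℚ (a i)) b u x₀ M x₀∈P refl u≤M
    μ   = proj₁ dual
    0≤μ = proj₁ (proj₂ dual)
    Σμa : combination μ (λ i → toℚ (a i)) ≗ u
    Σμa = proj₁ (proj₂ (proj₂ dual))
    Σμb : sum (λ i → μ i * b i) ≡ M
    Σμb = proj₂ (proj₂ (proj₂ dual))

    -- The terms are nonnegative and their sum is `M - ⟨ u , x ⟩`, which vanishes on the face. Hence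
    -- `μ i` can be nonzero only if facet `i` contains the whole face.
    complementary : ∀ x → Face carrier u x → ∀ i → μ i * (b i - ⟨ toℚ (a i) , x ⟩) ≡ 0ℚ
    complementary x (x∈P , u≤ux) = sum≡0⇒≡0 (λ i → μ i * (b i - ⟨ toℚ (a i) , x ⟩))
      (λ i → 0≤-* (0≤μ i) (p≤q⇒0≤q-p (x∈P i)))
      (trans (sum-cong-≗ (λ i → solve 3 (λ m b z → m :* (b :- z) := m :* b :- m :* z) refl (μ i) (b i) ⟨ toℚ (a i) , x ⟩))
        (trans (sum-sub (λ i → μ i * b i) (λ i → μ i * ⟨ toℚ (a i) , x ⟩))
          (trans (cong₂ _-_ Σμb (trans (sym (⟨,⟩-combinationˡ μ (λ i → toℚ (a i)) x))
            (trans (⟨,⟩-congˡ x Σμa) (≤-antisym (u≤M x x∈P) (u≤ux x₀ x₀∈P))))) (+-inverseʳ M))))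

    supported : ∀ i → i ∉ I → μ i ≡ 0ℚ
    supported i i∉I = cases (μ i ≟ 0ℚ)
      where
      cases : Dec (μ i ≡ 0ℚ) → μ i ≡ 0ℚ
      cases (yes μi≡0) = μi≡0
      cases (no μi≢0)  = contradiction (Equivalence.from (I⇔ i) (λ x x∈Face →
        sym (q-p≡0⇒q≡p (pq≡0⇒q≡0 (≰⇒> (λ μi≤0 → μi≢0 (≤-antisym μi≤0 (0≤μ i)))) (complementary x x∈Face i))))) i∉I

-- The optimal adjoint polytope and the denominator of c

sum-split : ∀ {k} (ν f g : Vector ℚ k) → sum (λ j → ν j * (f j - g j)) ≡ sum (λ j → ν j * f j) - sum (λ j → ν j * g j)
sum-split ν f g = trans (sum-cong-≗ (λ j → solve 3 (λ n f g → n :* (f :- g) := n :* f :- n :* g) refl (ν j) (f j) (g j)))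
  (sum-sub (λ j → ν j * f j) (λ j → ν j * g j))

module _ {d : ℕ} (P : LatticePolytope d) (c : ℚ) (0<c : 0ℚ < c) (x₀ : Point d) (x₀∈ : LatticePolytope.adjoint P c x₀) where
  open LatticePolytope P

  slackness : Fin n → ℚ
  slackness i = b i - c - ⟨ toℚ (a i) , x₀ ⟩

  0≤slackness : ∀ i → 0ℚ ≤ slackness i
  0≤slackness i = p≤q⇒0≤q-p (x₀∈ i)

  -- The index map lets one identity serve both the combinations read off a certificate and, with
  -- the identity map, the coefficient vectors of a cone.
  weighted-slackness : ∀ {k} (ν : Vector ℚ k) (idx : Fin k → Fin n) →
    sum (λ j → ν j * slackness (idx j)) ≡
    sum (λ j → ν j * b (idx j)) - c * sum ν - ⟨ combination ν (λ j → toℚ (a (idx j))) , x₀ ⟩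
  weighted-slackness ν idx = trans (sum-split ν (λ j → b (idx j) - c) (λ j → ⟨ toℚ (a (idx j)) , x₀ ⟩))
    (cong₂ _-_
      (trans (sum-split ν (λ j → b (idx j)) (λ _ → c)) (cong (λ z → sum (λ j → ν j * b (idx j)) - z) (trans (sum-*ʳ c ν) (*-comm (sum ν) c))))
      (sym (⟨,⟩-combinationˡ ν (λ j → toℚ (a (idx j))) x₀)))

  -- The support function of P − x₀ is at least c · height on each normal
  -- cone, and by convexity at most c · Σν on combinations of core normals.
  canonical⇒<sum : ∀ {α q} → CanonicalNormalFan α P → ℝ.lower α q → ∀ {k} (ν : Vector ℚ k) (idx : Fin k → Fin n) →
    (∀ j → 0ℚ ≤ ν j) → (∀ j → ν j * slackness (idx j) ≡ 0ℚ) →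
    ∀ (y : Lattice d) → combination ν (λ j → toℚ (a (idx j))) ≗ toℚ y → ¬ (y ≗ λ _ → 0ℤ) → q < sum ν
  canonical⇒<sum {α} {q} canonical q<α ν idx 0≤ν complementary y νa≗y y≢0 = from-cone (normal-cone P y)
    where
    u = toℚ y
    core : sum (λ j → ν j * b (idx j)) - ⟨ u , x₀ ⟩ ≡ c * sum ν
    core = trans
      (solve 3 (λ B C X → B :- X := (B :- C :- X) :+ C) refl (sum (λ j → ν j * b (idx j))) (c * sum ν) ⟨ u , x₀ ⟩)
      (trans (cong (_+ c * sum ν) (trans
        (cong (λ z → sum (λ j → ν j * b (idx j)) - c * sum ν - z) (sym (⟨,⟩-congˡ x₀ νa≗y)))
        (trans (sym (weighted-slackness ν idx)) (sum-zero (λ j → ν j * slackness (idx j)) complementary))))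
        (+-identityˡ (c * sum ν)))

    from-cone : (Σ (Subset n) λ I → NormalFan P I × InCone a I y ×
      (∃ λ x → carrier x × (∀ i → i ∈ I → ⟨ toℚ (a i) , x ⟩ ≡ b i))) → q < sum ν
    from-cone (I , I∈fan , y∈cone , x , x∈P , x-tight) = from-height (canonical I I∈fan y y≢0 y∈cone)
      where
      ux≤ : ⟨ u , x ⟩ ≤ sum (λ j → ν j * b (idx j))
      ux≤ = subst (_≤ sum (λ j → ν j * b (idx j)))
        (trans (sym (⟨,⟩-combinationˡ ν (λ j → toℚ (a (idx j))) x)) (⟨,⟩-congˡ x νa≗y))
        (weighted-sum-≤ ν 0≤ν (λ j → ⟨ toℚ (a (idx j)) , x ⟩) (λ j → b (idx j)) (λ j → x∈P (idx j)))

      from-height : (∃ λ h → IsHeight a I y h × α ≤ℝ fromℚ h) → q < sum ν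
      -- The gap `c * sum ν - c * h` is the weighted slackness of the representation in the cone
      -- plus the gap in `ux≤`.
      from-height (h , ((μ , (0≤μ , supported , μa≗y) , Σμ≡h) , _) , α≤h) = <-≤-trans (α≤h q q<α)
        (*-cancelˡ-≤-pos c {{positive 0<c}} (≤-via
          (sum (λ i → μ i * slackness i) + (sum (λ j → ν j * b (idx j)) - ⟨ u , x ⟩))
          (0≤-+ (sum-nonneg (λ i → μ i * slackness i) (λ i → 0≤-* (0≤μ i) (0≤slackness i))) (p≤q⇒0≤q-p ux≤))
          (sym (trans (cong (_+ (sum (λ j → ν j * b (idx j)) - ⟨ u , x ⟩)) cone-side)
            (trans (solve 4 (λ B C X Y → (Y :- C :- X) :+ (B :- Y) := (B :- X) :- C) refl
                (sum (λ j → ν j * b (idx j))) (c * h) ⟨ u , x₀ ⟩ ⟨ u , x ⟩)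
              (cong (_- c * h) core))))))
        where
        term : ∀ i → Dec (i ∈ I) → μ i * b i ≡ μ i * ⟨ toℚ (a i) , x ⟩
        term i (yes i∈I) = cong (μ i *_) (sym (x-tight i i∈I))
        term i (no i∉I)  = trans (trans (cong (_* b i) (supported i i∉I)) (*-zeroˡ (b i)))
          (sym (trans (cong (_* ⟨ toℚ (a i) , x ⟩) (supported i i∉I)) (*-zeroˡ ⟨ toℚ (a i) , x ⟩)))
        Σμb : sum (λ i → μ i * b i) ≡ ⟨ u , x ⟩
        Σμb = trans (sum-cong-≗ (λ i → term i (i ∈? I))) (trans (sym (⟨,⟩-combinationˡ μ (λ i → toℚ (a i)) x)) (⟨,⟩-congˡ x μa≗y))
        cone-side : sum (λ i → μ i * slackness i) ≡ ⟨ u , x ⟩ - c * h - ⟨ u , x₀ ⟩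
        cone-side = trans (weighted-slackness μ (λ i → i))
          (cong₂ _-_ (cong₂ _-_ Σμb (cong (c *_) Σμ≡h)) (⟨,⟩-congˡ x₀ μa≗y))

  core-denominator : ∀ {α q} → CanonicalNormalFan α P → ℝ.lower α q →
    (∀ t → 0ℚ < t × ∃ (adjoint t) → t ≤ c) → (approx : ∃ λ B → ∀ x → (∀ j → 0ℚ ≤ x j) → sum x ≡ 1ℚ → Approximation {2 ℕ.^ d} q B x) →
    ∃ λ D → 1 ℕ.≤ D × D ℕ.≤ proj₁ approx × Integral (c * ι D)
  core-denominator {α} {q} canonical q<α maximal approx =
    from-certificate (lp-duality (λ i → toℚ (a i)) b (λ _ → 1ℚ) c x₀
      (λ i → subst (λ z → ⟨ toℚ (a i) , x₀ ⟩ ≤ b i - z) (sym (*-identityʳ c)) (x₀∈ i)) infeasible) approx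
    where
    infeasible : ∀ t x → (∀ i → ⟨ toℚ (a i) , x ⟩ ≤ b i - t * 1ℚ) → t ≤ c
    infeasible t x ok = cases (0ℚ <? t)
      where
      cases : Dec (0ℚ < t) → t ≤ c
      cases (yes 0<t) = maximal t (0<t , x , λ i → subst (λ z → ⟨ toℚ (a i) , x ⟩ ≤ b i - z) (*-identityʳ t) (ok i))
      -- Maximality of `c` speaks of positive `t` only; the remaining `t` lie below `c` because `c`
      -- is positive.
      cases (no t≯0)  = ≤-trans (≮⇒≥ t≯0) (<⇒≤ 0<c)

    from-certificate : (∃ λ l → IsCertificate (λ i → toℚ (a i)) l × 0ℚ < value l (λ _ → 1ℚ) × value l b ≡ c * value l (λ _ → 1ℚ)) →
      (approx : ∃ λ B → ∀ x → (∀ j → 0ℚ ≤ x j) → sum x ≡ 1ℚ → Approximation {2 ℕ.^ d} q B x) →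
      ∃ λ D → 1 ℕ.≤ D × D ℕ.≤ proj₁ approx × Integral (c * ι D)
    from-certificate (l , (len , 0≤l , ann) , 0<W , tight) approx =
      at-length (subst (λ K → ∀ x → (∀ j → 0ℚ ≤ x j) → sum x ≡ 1ℚ → Approximation {K} q (proj₁ approx) x) (sym len) (proj₂ approx))
      where
      K = length l
      idx : Fin K → Fin n
      idx = index l
      W = value l (λ _ → 1ℚ)
      r = proj₁ (reciprocal 0<W)
      0<r = proj₁ (proj₂ (reciprocal 0<W))
      rW≡1 : r * W ≡ 1ℚ
      rW≡1 = proj₂ (proj₂ (reciprocal 0<W))

      ϑ : Vector ℚ K
      ϑ j = r * weight l j

      0≤ϑ : ∀ j → 0ℚ ≤ ϑ j
      0≤ϑ j = 0≤-* (<⇒≤ 0<r) (0≤l j)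

      scaled : ∀ f → sum (λ j → ϑ j * f (idx j)) ≡ r * value l f
      scaled f = trans (sum-cong-≗ (λ j → *-assoc r (weight l j) (f (idx j)))) (sum-*ˡ r (λ j → weight l j * f (idx j)))

      Σϑ≡1 : sum ϑ ≡ 1ℚ
      Σϑ≡1 = trans (sum-cong-≗ (λ j → sym (*-identityʳ (ϑ j)))) (trans (scaled (λ _ → 1ℚ)) rW≡1)

      Σϑa≡0 : ∀ k → combination ϑ (λ j → toℚ (a (idx j))) k ≡ 0ℚ
      Σϑa≡0 k = trans (scaled (λ i → toℚ (a i) k)) (trans (cong (r *_) (ann k)) (*-zeroʳ r))

      Σϑb≡c : sum (λ j → ϑ j * b (idx j)) ≡ c
      Σϑb≡c = trans (scaled b) (trans (cong (r *_) tight)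
        (trans (solve 3 (λ r c W → r :* (c :* W) := c :* (r :* W)) refl r c W) (trans (cong (c *_) rW≡1) (*-identityʳ c))))

      ϑ-slack : ∀ j → ϑ j * slackness (idx j) ≡ 0ℚ
      ϑ-slack = sum≡0⇒≡0 (λ j → ϑ j * slackness (idx j)) (λ j → 0≤-* (0≤ϑ j) (0≤slackness (idx j)))
        (trans (weighted-slackness ϑ idx) (trans
          (cong₂ _-_ (cong₂ _-_ Σϑb≡c (trans (cong (c *_) Σϑ≡1) (*-identityʳ c)))
            (trans (⟨,⟩-congˡ x₀ Σϑa≡0) (sum-zero (λ k → 0ℚ * x₀ k) (λ k → *-zeroˡ (x₀ k)))))
          (solve 1 (λ c → c :- c :- con 0ℚ := con 0ℚ) refl c)))

      at-length : (∀ x → (∀ j → 0ℚ ≤ x j) → sum x ≡ 1ℚ → Approximation {K} q (proj₁ approx) x) →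
        ∃ λ D → 1 ℕ.≤ D × D ℕ.≤ proj₁ approx × Integral (c * ι D)
      at-length approximant = D , 1≤D , D≤B , subst Integral Σpb≡cD
        (integral-sum (λ j → ι (p j) * b (idx j)) (λ j → integral-* (ℤ.+ p j , sym (ι-def (p j))) (b-integral P (idx j))))
        where
        open Approximation (approximant ϑ 0≤ϑ Σϑ≡1)
        T = ι D + q

        ν : Vector ℚ K
        ν j = T * ϑ j - ι (p j)

        0≤ν : ∀ j → 0ℚ ≤ ν j
        0≤ν j = p≤q⇒0≤q-p (below j)

        Σν≡q : sum ν ≡ q
        Σν≡q = trans (sum-sub (λ j → T * ϑ j) (λ j → ι (p j)))
          (trans (cong₂ _-_ (trans (sum-*ˡ T ϑ) (trans (cong (T *_) Σϑ≡1) (*-identityʳ T))) (sym ιD))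
            (solve 2 (λ D q → D :+ q :- D := q) refl (ι D) q))

        -- From `0 ≤ p j ≤ T * ϑ j` the support of `p` lies in that of `ϑ`, so `p` too uses only
        -- facets tight at `x₀`.
        p-slack : ∀ j → ι (p j) * slackness (idx j) ≡ 0ℚ
        p-slack j = ≤-antisym
          (subst (ι (p j) * slackness (idx j) ≤_)
            (trans (*-assoc T (ϑ j) (slackness (idx j))) (trans (cong (T *_) (ϑ-slack j)) (*-zeroʳ T)))
            (*-monoʳ-≤-nonNeg (slackness (idx j)) {{nonNegative (0≤slackness (idx j))}} (below j)))
          (0≤-* (0≤ι (p j)) (0≤slackness (idx j)))

        ν-slack : ∀ j → ν j * slackness (idx j) ≡ 0ℚ
        ν-slack j = trans (solve 4 (λ T t p s → (T :* t :- p) :* s := T :* (t :* s) :- p :* s) refl T (ϑ j) (ι (p j)) (slackness (idx j)))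
          (trans (cong₂ (λ x y → T * x - y) (ϑ-slack j) (p-slack j)) (solve 1 (λ T → T :* con 0ℚ :- con 0ℚ := con 0ℚ) refl T))

        pa : Point d
        pa = combination (λ j → ι (p j)) (λ j → toℚ (a (idx j)))

        pa-integral : ∀ k → Integral (- 1ℚ * pa k)
        pa-integral k = integral-* (ℤ.- ℤ.+ 1 , refl) (integral-sum (λ j → ι (p j) * toℚ (a (idx j)) k)
          (λ j → integral-* (ℤ.+ p j , sym (ι-def (p j))) (a (idx j) k , refl)))

        y : Lattice d
        y k = proj₁ (pa-integral k)

        νa≗y : combination ν (λ j → toℚ (a (idx j))) ≗ toℚ y
        νa≗y k = trans
          (trans (sum-cong-≗ (λ j → solve 4 (λ T t p a → (T :* t :- p) :* a := T :* (t :* a) :- p :* a) refl T (ϑ j) (ι (p j)) (toℚ (a (idx j)) k)))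
          (trans (sum-sub (λ j → T * (ϑ j * toℚ (a (idx j)) k)) (λ j → ι (p j) * toℚ (a (idx j)) k))
          (trans (cong (_- pa k) (trans (sum-*ˡ T (λ j → ϑ j * toℚ (a (idx j)) k)) (cong (T *_) (Σϑa≡0 k))))
          (solve 2 (λ T s → T :* con 0ℚ :- s := con (- 1ℚ) :* s) refl T (pa k)))))
          (sym (proj₂ (pa-integral k)))

        -- Refuting `y ≢ 0` suffices, since equality of integers is decidable; a nonzero `y` would
        -- give `q < sum ν`, while the remainders sum to exactly `q`.
        y≡0 : ∀ k → y k ≡ 0ℤ
        y≡0 = cases (all? (λ k → y k ℤ.≟ 0ℤ))
          where
          cases : Dec (∀ k → y k ≡ 0ℤ) → ∀ k → y k ≡ 0ℤ
          cases (yes y≡0) = y≡0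
          cases (no y≢0)  = contradiction
            (subst (q <_) Σν≡q (canonical⇒<sum {α} {q} canonical q<α ν idx 0≤ν ν-slack y νa≗y y≢0)) (<-irrefl refl)

        pa≡0 : ∀ k → pa k ≡ 0ℚ
        pa≡0 k = trans (solve 1 (λ s → s := con (- 1ℚ) :* (con (- 1ℚ) :* s)) refl (pa k))
          (cong (- 1ℚ *_) (trans (sym (proj₂ (pa-integral k))) (cong (_/ 1) (y≡0 k))))

        -- This is `weighted-slackness` for `p`: the left-hand side vanishes by `p-slack`, and the
        -- term with `x₀` vanishes because `pa` is zero.
        Σpb≡cD : sum (λ j → ι (p j) * b (idx j)) ≡ c * ι D
        Σpb≡cD = q-p≡0⇒q≡p (trans
          (solve 2 (λ B C → B :- C := B :- C :- con 0ℚ) refl (sum (λ j → ι (p j) * b (idx j))) (c * ι D))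
          (trans (cong₂ (λ s t → sum (λ j → ι (p j) * b (idx j)) - c * s - t) ιD
            (sym (trans (⟨,⟩-congˡ x₀ pa≡0) (sum-zero (λ k → 0ℚ * x₀ k) (λ k → *-zeroˡ (x₀ k))))))
          (trans (sym (weighted-slackness (λ j → ι (p j)) idx)) (sum-zero (λ j → ι (p j) * slackness (idx j)) p-slack))))

-- The finite list of possible codegrees

fraction : ℕ → ℕ → ℚ
fraction D N = (ℤ.+ D) / suc N

fraction-* : ∀ D N → fraction D N * ι (suc N) ≡ ι D
fraction-* D N = trans (cong (fraction D N *_) (ι-def (suc N))) (trans (toℚᵘ-injective (begin
  toℚᵘ (fraction D N * ((ℤ.+ suc N) / 1))                    ≈⟨ toℚᵘ-homo-* (fraction D N) ((ℤ.+ suc N) / 1) ⟩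
  toℚᵘ (fraction D N) ℚᵘ.* toℚᵘ ((ℤ.+ suc N) / 1)             ≈⟨ ℚᵘ.*-cong (toℚᵘ-fromℚᵘ (ℚᵘ.mkℚᵘ (ℤ.+ D) N)) (toℚᵘ-/1 (ℤ.+ suc N)) ⟩
  ℚᵘ.mkℚᵘ (ℤ.+ D) N ℚᵘ.* ℚᵘ.mkℚᵘ (ℤ.+ suc N) 0               ≈⟨ ℚᵘ.*≡* (trans (ℤ.*-assoc (ℤ.+ D) (ℤ.+ suc N) (ℤ.+ 1)) (cong (λ z → ℤ.+ D ℤ.* z) (sym (ℤ.pos-* (suc N) 1)))) ⟩
  ℚᵘ.mkℚᵘ (ℤ.+ D) 0                                        ≈⟨ toℚᵘ-/1 (ℤ.+ D) ⟨
  toℚᵘ ((ℤ.+ D) / 1)                                       ∎)) (sym (ι-def D)))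
  where open ℚᵘ.≃-Reasoning

positive-integer : ∀ z → 0ℚ < z / 1 → ∃ λ N → z / 1 ≡ ι (suc N)
positive-integer (ℤ.+ suc N) _   = N , sym (ι-def (suc N))
positive-integer (ℤ.+ zero)  0<z = contradiction 0<z (<-irrefl refl)
positive-integer -[1+ N ]    0<z = contradiction (<-≤-trans 0<z (/1-mono-≤ -[1+ N ] (ℤ.+ 0) ℤ.-≤+)) (<-irrefl refl)

theorem3p1 : (d : ℕ) (α ε : ℝ) → 0ℝ <ℝ α → 0ℝ <ℝ ε →
    Finite (λ q → Σ (LatticePolytope d) λ P →
    CanonicalNormalFan α P × IsQCodegree P q × ε ≤ℝ fromℚ q)
theorem3p1 d α ε (α′ , 0<α′ , α′<α) (ε′ , 0<ε′ , ε′<ε) =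
  -- The codegree is `D / (c D)` with `D ≤ B` and `c D = suc N ≤ C`; hence `D` ranges below `suc B`
  -- and `N` below `C`.
  cartesianProductWith fraction (upTo (suc B)) (upTo C) , member
  where
  -- Positivity of the cut `α` consists of a positive rational `α′` in its lower part, so the bound
  -- is fixed before any polytope is given.
  approx = approximate (2 ℕ.^ d) α′ 0<α′
  B = proj₁ approx
  ρ = proj₁ (reciprocal 0<ε′)
  0<ρ = proj₁ (proj₂ (reciprocal 0<ε′))
  ρε′≡1 : ρ * ε′ ≡ 1ℚ
  ρε′≡1 = proj₂ (proj₂ (reciprocal 0<ε′))
  -- Since `q` times `c D` is `D`, at most `B`, and `q > ε′`, the integer `c D` is at most `B / ε′`.
  C = proj₁ (archimedean (ρ * ι B))

  member : ∀ q → (Σ (LatticePolytope d) λ P → CanonicalNormalFan α P × IsQCodegree P q × ε ≤ℝ fromℚ q) →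
    q List.∈ cartesianProductWith fraction (upTo (suc B)) (upTo C)
  member q (P , canonical , (c , ((0<c , x₀ , x₀∈) , maximal) , qc≡1) , ε≤q) =
    from-denominator (core-denominator P c 0<c x₀ x₀∈ {α} {α′} canonical α′<α maximal approx)
    where
    ε′<q : ε′ < q
    ε′<q = ε≤q ε′ ε′<ε

    from-denominator : (∃ λ D → 1 ℕ.≤ D × D ℕ.≤ B × Integral (c * ι D)) → q List.∈ cartesianProductWith fraction (upTo (suc B)) (upTo C)
    from-denominator (D , 1≤D , D≤B , z , z≡cD) = from-numerator (positive-integer z (subst (0ℚ <_) (sym z≡cD) (0<-* 0<c (0<ι 1≤D))))
      where
      from-numerator : (∃ λ N → z / 1 ≡ ι (suc N)) → q List.∈ cartesianProductWith fraction (upTo (suc B)) (upTo C)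
      from-numerator (N , z≡N) = subst (List._∈ cartesianProductWith fraction (upTo (suc B)) (upTo C)) (sym q≡)
        (∈-cartesianProductWith⁺ fraction (∈-upTo⁺ (s≤s D≤B)) (∈-upTo⁺ N<C))
        where
        cD≡N : c * ι D ≡ ι (suc N)
        cD≡N = trans (sym z≡cD) z≡N

        qN≡D : q * ι (suc N) ≡ ι D
        qN≡D = trans (cong (q *_) (sym cD≡N)) (trans (sym (*-assoc q c (ι D))) (trans (cong (_* ι D) qc≡1) (*-identityˡ (ι D))))

        q≡ : q ≡ fraction D N
        q≡ = q-p≡0⇒q≡p (pq≡0⇒q≡0 (0<ι {suc N} (s≤s z≤n)) (trans
          (solve 3 (λ n q f → n :* (q :- f) := q :* n :- f :* n) refl (ι (suc N)) q (fraction D N))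
          (trans (cong₂ _-_ qN≡D (fraction-* D N)) (+-inverseʳ (ι D)))))

        N<C : suc N ℕ.≤ C
        N<C = ι-cancel (≤-trans (≤-via (ρ * ((ι B - ι D) + (q - ε′) * ι (suc N)))
            (0≤-* (<⇒≤ 0<ρ) (0≤-+ (p≤q⇒0≤q-p (ι-mono D≤B)) (0≤-* (p≤q⇒0≤q-p (<⇒≤ ε′<q)) (0≤ι (suc N)))))
            (sym (trans (solve 6 (λ r B D q e n → r :* ((B :- D) :+ (q :- e) :* n) := r :* B :+ r :* (q :* n :- D) :- (r :* e) :* n) refl
                ρ (ι B) (ι D) q ε′ (ι (suc N)))
              (trans (cong₂ (λ s t → ρ * ι B + ρ * (s - ι D) - t * ι (suc N)) qN≡D ρε′≡1)
                (solve 4 (λ r B D n → r :* B :+ r :* (D :- D) :- con 1ℚ :* n := r :* B :- n) refl ρ (ι B) (ι D) (ι (suc N)))))))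
          (proj₂ (archimedean (ρ * ι B))))
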